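{- For every $n,k\in\mathbb N$ with $n\ge 2k$, $$(k-1)n\le ex_<(n,\neg\text{Nest- }\mathcal M_k)\le ex_<(n,\neg\text{Nest*- }\mathcal M_k)\le (k-1)n+\binom{k-1}{2}.$$
   Context: An ordered graph on $n$ vertices is a graph with vertex set $[n]$ with its natural order. An ordered graph $G$ contains a copy of an ordered graph $H$ if there is an injective, order-preserving map $V(H)\to V(G)$ sending edges to edges. For a family $\mathcal H$ of ordered graphs, $ex_<(n,\mathcal H)$ is the maximum number of edges of an ordered graph on $[n]$ containing no copy of any member of $\mathcal H$. Two vertex-disjoint edges $xy$, $uv$ with $x<y$, $u<v$ are separated if $[x,y]\cap[u,v]=\emptyset$; nested if one of the intervals $[x,y],[u,v]$ contains the other; crossing otherwise. A $k$-matching is a set of $k$ pairwise vertex-disjoint edges. A matching is crossing if every pair of its edges crosses, and non-nested if no pair of its edges is nested. $\neg\text{Nest- }\mathcal M_k$ denotes the family of non-nested $k$-matchings. A $k$-matching is strongly non-nested if it is a disjoint union of crossing matchings such that two of its edges cross if and only if they belong to the same one of these crossing matchings (so edges from different parts are separated); $\neg\text{Nest*- }\mathcal M_k$ denotes the family of strongly non-nested $k$-matchings. -}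

module Defs where

open import Data.Nat using (ℕ; _+_; _<ᵇ_; _≤_)
open import Data.Fin using (Fin; toℕ; _<_)
open import Data.Bool using (Bool; true; false; if_then_else_; _∧_)
open import Data.List using (List; map; allFin)
open import Data.Nat.ListAction using (sum)
open import Data.Product using (_×_; ∃-syntax; Σ)
open import Data.Sum using (_⊎_)
open import Relation.Nullary using (¬_)
open import Relation.Binary.PropositionalEquality using (_≡_; _≢_)

-- An ordered graph on [n] (vertex set Fin n with its natural order).
-- The edge {i,j} with i < j is present iff G i j ≡ true; entries with
-- i ≥ j are ignored (only the upper triangle matters).
OGraph : ℕ → Set
OGraph n = Fin n → Fin n → Bool

Edge : ∀ {n} → OGraph n → Fin n → Fin n → Set
Edge G i j = (i < j) × (G i j ≡ true)

numEdges : ∀ {n} → OGraph n → ℕ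
numEdges {n} G =
  sum (map (λ i → sum (map (λ j → if (toℕ i <ᵇ toℕ j) ∧ G i j then 1 else 0)
                           (allFin n)))
           (allFin n))

-- Relations between two edges xy, uv (x < y, u < v), as in the paper
-- (for vertex-disjoint edges).
Separated : ∀ {m} → Fin m → Fin m → Fin m → Fin m → Set
Separated x y u v = (y < u) ⊎ (v < x)

Nested : ∀ {m} → Fin m → Fin m → Fin m → Fin m → Set
Nested x y u v = ((x < u) × (v < y)) ⊎ ((u < x) × (y < v))

Crossing : ∀ {m} → Fin m → Fin m → Fin m → Fin m → Set
Crossing x y u v = ¬ Separated x y u v × ¬ Nested x y u v

-- A k-matching as an ordered graph: vertex set Fin (k + k), edges
-- lo i < hi i for i : Fin k, pairwise vertex-disjoint (hence covering
-- all 2k vertices), and no other edges.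
record Matching (k : ℕ) : Set where
  field
    lo hi : Fin k → Fin (k + k)
    lo<hi : ∀ i → lo i < hi i
    disjoint : ∀ i j → i ≢ j →
      (lo i ≢ lo j) × (lo i ≢ hi j) × (hi i ≢ lo j) × (hi i ≢ hi j)
open Matching public

MEdge : ∀ {k} → Matching k → Fin (k + k) → Fin (k + k) → Set
MEdge M a b = ∃[ i ] (lo M i ≡ a × hi M i ≡ b)

NonNested : ∀ {k} → Matching k → Set
NonNested M = ∀ i j → i ≢ j → ¬ Nested (lo M i) (hi M i) (lo M j) (hi M j)

StronglyNonNested : ∀ {k} → Matching k → Set
StronglyNonNested {k} M = Σ (Fin k → Fin k) λ part → ∀ i j → i ≢ j →
  ((part i ≡ part j) → Crossing (lo M i) (hi M i) (lo M j) (hi M j)) ×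
  ((part i ≢ part j) → Separated (lo M i) (hi M i) (lo M j) (hi M j))

ContainsCopy : ∀ {n k} → OGraph n → Matching k → Set
ContainsCopy {n} {k} G M = Σ (Fin (k + k) → Fin n) λ f →
  (∀ (a b : Fin (k + k)) → a < b → f a < f b) ×
  (∀ a b → MEdge M a b → Edge G (f a) (f b))

Family : ℕ → Set₁
Family k = Matching k → Set

NonNestFam : ∀ k → Family k
NonNestFam k = NonNested

StrongNonNestFam : ∀ k → Family k
StrongNonNestFam k = StronglyNonNested

Free : ∀ {n k} → OGraph n → Family k → Set
Free {k = k} G 𝓗 = ∀ (M : Matching k) → 𝓗 M → ¬ ContainsCopy G M

IsEx : ∀ {k} → ℕ → Family k → ℕ → Set
IsEx n 𝓗 m = (∃[ G ] (Free {n} G 𝓗 × numEdges G ≡ m)) ×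
             (∀ (G : OGraph n) → Free G 𝓗 → numEdges G ≤ m)

{-# OPTIONS --safe #-}
module Submission where

-- Put κ = k − 1.  Lower bound: in a non-nested k-matching the edge with the largest left end
-- has left end ≥ κ and right end ≥ 2κ + 1 (vertices counted from 0), so the κn pairs i < j with
-- i < κ or j < 2κ + 1 contain no such matching.
--
-- Upper bound: for each d ≤ κ at most 2κ edges have length d.  Indeed, cut the line into
-- consecutive blocks of length d; the edges of length d whose right ends lie in even (or in odd)
-- blocks cross within a block and are separated between different blocks.  The edges of
-- length > κ are counted with the theorem of Capoyleas and Pach: a graph on n ≥ 2κ + 1 ordered
-- vertices without κ + 1 pairwise crossing edges has at most 2κn − κ(2κ + 1) edges.  Applied to
-- the graph in which all edges of length ≤ κ are filled in (they never lie in κ + 1 pairwise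
-- crossing edges), it leaves κn − κ(3κ + 1)/2 edges of length > κ.
--
-- Capoyleas–Pach is proved by induction on n.  If vertex 0 has no edge of cyclic length > κ,
-- delete it.  Otherwise let 0y be such an edge.  Give each edge crossing 0y its rank, the size
-- of the longest chain of pairwise crossing edges (all crossing 0y) that it tops.  Only
-- s = κ − 1 ranks occur.  Replace everything beyond y, respectively everything strictly between
-- 0 and y, by s new vertices, and attach each edge of rank r to the r-th of them.  Neither new
-- graph has κ + 1 pairwise crossing edges, and the edges of one rank form a staircase, so their
-- number is less than the number of their left ends plus the number of their right ends.

open import Defs
open import Data.Nat
open import Data.Nat.Properties
open import Data.Nat.Combinatorics using (_C_; nC1≡n; nCk+nC[k+1]≡[n+1]C[k+1])
open import Data.Nat.DivMod using (m≡m%n+[m/n]*n; m%n<n; /-monoˡ-≤)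
open import Data.Nat.Induction using (<-wellFounded)
open import Data.Nat.ListAction using (sum)
open import Data.Nat.Tactic.RingSolver using (solve-∀)
open import Data.Bool using (Bool; true; false; if_then_else_; _∧_; _∨_; not; T)
import Data.Bool.Properties as Bool
open import Data.Fin using (Fin; zero; suc; toℕ; fromℕ<; inject₁; _↑ˡ_; _↑ʳ_; splitAt; join) renaming (_<_ to _<ᶠ_)
open import Data.Fin.Properties as Finₚ using () renaming (_≟_ to _≟ᶠ_; _<?_ to _<?ᶠ_)
open import Data.List as List using (map; allFin)
open import Data.List.Properties using (map-cong; map-tabulate)
open import Data.Product using (_×_; ∃-syntax; Σ; _,_; proj₁; proj₂; map₂)
open import Data.Sum as Sum using (_⊎_; inj₁; inj₂; [_,_]′; swap)
open import Data.Vec using (Vec; []; _∷_; lookup; tabulate)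
open import Data.Vec.Properties using (lookup∘tabulate)
open import Function using (_∘_; id; case_of_; Injective)
open import Induction.WellFounded using (Acc; acc)
open import Relation.Binary.Definitions using (tri<; tri≈; tri>)
open import Relation.Binary.PropositionalEquality
open import Relation.Nullary using (¬_; Dec; yes; no; contradiction; ¬?; _×-dec_; _⊎-dec_; _→-dec_; map′)

-- Finite sums, Boolean indicators and the staircase count.

∑ : ℕ → (ℕ → ℕ) → ℕ
∑ zero    f = 0
∑ (suc n) f = ∑ n f + f n

∑-mono : ∀ n {f g} → (∀ i → i < n → f i ≤ g i) → ∑ n f ≤ ∑ n g
∑-mono zero    f≤g = z≤n
∑-mono (suc n) f≤g = +-mono-≤ (∑-mono n (λ i i<n → f≤g i (m<n⇒m<1+n i<n))) (f≤g n ≤-refl)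

∑-cong : ∀ n {f g} → (∀ i → i < n → f i ≡ g i) → ∑ n f ≡ ∑ n g
∑-cong zero    f≡g = refl
∑-cong (suc n) f≡g = cong₂ _+_ (∑-cong n (λ i i<n → f≡g i (m<n⇒m<1+n i<n))) (f≡g n ≤-refl)

∑-+ : ∀ n f g → ∑ n (λ i → f i + g i) ≡ ∑ n f + ∑ n g
∑-+ zero    f g = refl
∑-+ (suc n) f g = trans (cong (_+ (f n + g n)) (∑-+ n f g)) (eq (∑ n f) (∑ n g) (f n) (g n))
  where
  eq : ∀ a b c d → a + b + (c + d) ≡ a + c + (b + d)
  eq = solve-∀

∑-const : ∀ n c → ∑ n (λ _ → c) ≡ n * c
∑-const zero    c = refl
∑-const (suc n) c = trans (cong (_+ c) (∑-const n c)) (+-comm (n * c) c)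

∑-zero : ∀ n {f} → (∀ i → i < n → f i ≡ 0) → ∑ n f ≡ 0
∑-zero n f≡0 = trans (∑-cong n f≡0) (trans (∑-const n 0) (*-zeroʳ n))

∑-split : ∀ m n f → ∑ (m + n) f ≡ ∑ m f + ∑ n (λ i → f (m + i))
∑-split m zero    f = trans (cong (λ k → ∑ k f) (+-identityʳ m)) (sym (+-identityʳ _))
∑-split m (suc n) f = trans (cong (λ k → ∑ k f) (+-suc m n))
  (trans (cong (_+ f (m + n)) (∑-split m n f)) (+-assoc (∑ m f) _ _))

∑-swap : ∀ m n (f : ℕ → ℕ → ℕ) → ∑ m (λ i → ∑ n (f i)) ≡ ∑ n (λ j → ∑ m (λ i → f i j))
∑-swap zero    n f = sym (∑-zero n (λ _ _ → refl))
∑-swap (suc m) n f = trans (cong (_+ ∑ n (f m)) (∑-swap m n f)) (sym (∑-+ n _ (f m)))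

∑-pos : ∀ n f → 0 < ∑ n f → ∃[ i ] (i < n × 0 < f i)
∑-pos (suc n) f p with f n in eq
... | suc c = n , ≤-refl , subst (0 <_) (sym eq) z<s
... | zero  = let i , i<n , q = ∑-pos n f (subst (0 <_) (+-identityʳ _) p)
              in i , m<n⇒m<1+n i<n , q

term≤∑ : ∀ n f {i} → i < n → f i ≤ ∑ n f
term≤∑ (suc n) f i<1+n with m≤n⇒m<n∨m≡n (≤-pred i<1+n)
... | inj₁ i<n  = ≤-trans (term≤∑ n f i<n) (m≤m+n _ _)
... | inj₂ refl = m≤n+m _ _

∑-id : ∀ n → 2 * ∑ n (λ i → i) + n ≡ n * n
∑-id zero    = refl
∑-id (suc n) = trans (eq₁ (∑ n (λ i → i)) n) (trans (cong (λ k → k + (n + 1 + n)) (∑-id n)) (eq₂ n))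
  where
  eq₁ : ∀ a n → 2 * (a + n) + (1 + n) ≡ 2 * a + n + (n + 1 + n)
  eq₁ = solve-∀
  eq₂ : ∀ n → n * n + (n + 1 + n) ≡ (1 + n) * (1 + n)
  eq₂ = solve-∀

⟦_⟧ : Bool → ℕ
⟦ b ⟧ = if b then 1 else 0

⟦⟧≤1 : ∀ b → ⟦ b ⟧ ≤ 1
⟦⟧≤1 true  = ≤-refl
⟦⟧≤1 false = z≤n

⟦⟧-mono : ∀ {b c} → (b ≡ true → c ≡ true) → ⟦ b ⟧ ≤ ⟦ c ⟧
⟦⟧-mono {false} b⇒c = z≤n
⟦⟧-mono {true}  b⇒c rewrite b⇒c refl = ≤-refl

⟦⟧-pos : ∀ {b} → 0 < ⟦ b ⟧ → b ≡ true
⟦⟧-pos {true} _ = refl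

⟦⟧-zero : ∀ {b} → ¬ (b ≡ true) → ⟦ b ⟧ ≡ 0
⟦⟧-zero {false} _ = refl
⟦⟧-zero {true}  p = contradiction refl p

∧-true : ∀ {b c} → b ∧ c ≡ true → b ≡ true × c ≡ true
∧-true {true} {true} _ = refl , refl

∧-intro : ∀ {b c} → b ≡ true → c ≡ true → b ∧ c ≡ true
∧-intro refl refl = refl

∨-true : ∀ {b c} → b ∨ c ≡ true → b ≡ true ⊎ c ≡ true
∨-true {true}  _ = inj₁ refl
∨-true {false} p = inj₂ p

∨-introˡ : ∀ {b c} → b ≡ true → b ∨ c ≡ true
∨-introˡ refl = refl

∨-introʳ : ∀ {b c} → c ≡ true → b ∨ c ≡ true
∨-introʳ {true}  _ = refl
∨-introʳ {false} p = p

T⇒≡ : ∀ {b} → T b → b ≡ true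
T⇒≡ {true} _ = refl

≡⇒T : ∀ {b} → b ≡ true → T b
≡⇒T refl = _

<⇒<ᵇ≡ : ∀ {m n} → m < n → (m <ᵇ n) ≡ true
<⇒<ᵇ≡ = T⇒≡ ∘ <⇒<ᵇ

<ᵇ≡⇒< : ∀ {m n} → (m <ᵇ n) ≡ true → m < n
<ᵇ≡⇒< {m} {n} = <ᵇ⇒< m n ∘ ≡⇒T

≥⇒<ᵇ≡ : ∀ {m n} → n ≤ m → (m <ᵇ n) ≡ false
≥⇒<ᵇ≡ {m} {n} n≤m with m <ᵇ n in eq
... | false = refl
... | true  = contradiction (<ᵇ≡⇒< eq) (≤⇒≯ n≤m)

some : ℕ → (ℕ → Bool) → Bool
some n p = 0 <ᵇ ∑ n (λ i → ⟦ p i ⟧)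

some-intro : ∀ n (p : ℕ → Bool) {i} → i < n → p i ≡ true → some n p ≡ true
some-intro n p {i} i<n pi = <⇒<ᵇ≡ (≤-trans (subst (λ b → 1 ≤ ⟦ b ⟧) (sym pi) ≤-refl) (term≤∑ n (λ i → ⟦ p i ⟧) i<n))

some-elim : ∀ n (p : ℕ → Bool) → some n p ≡ true → ∃[ i ] (i < n × p i ≡ true)
some-elim n p s with i , i<n , q ← ∑-pos n _ (<ᵇ≡⇒< s) = i , i<n , ⟦⟧-pos q

-- Apart from the corner (a − 1, 0) of the grid, row a − 1 or column 0 contains no cell of Q, and can
-- be removed.
staircase : ∀ a b (Q : ℕ → ℕ → Bool) (U V : ℕ → Bool) →
  (∀ {i j i′ j′} → i < i′ → Q i j ≡ true → Q i′ j′ ≡ true → j′ ≤ j) →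
  (∀ {i j} → i < a → j < b → Q i j ≡ true → U i ≡ true × V j ≡ true) →
  ∃[ j ] (j < b × V j ≡ true) →
  ∑ a (λ i → ∑ b (λ j → ⟦ Q i j ⟧)) + 1 ≤ ∑ a (λ i → ⟦ U i ⟧) + ∑ b (λ j → ⟦ V j ⟧)
-- With no row left, the surplus 1 is paid for by the column known to lie in `V`.
staircase zero b Q U V anti UV (j , j<b , Vj) =
  ≤-trans (subst (λ v → 1 ≤ ⟦ v ⟧) (sym Vj) ≤-refl) (term≤∑ b (λ j → ⟦ V j ⟧) j<b)
staircase (suc a) (suc b) Q U V anti UV ∃V
  with ∑ b (λ j → ⟦ Q a (1 + j) ⟧) in rowEq
... | zero = begin
    S + ∑ (1 + b) (λ j → ⟦ Q a j ⟧) + 1   ≡⟨ cong (λ c → S + c + 1) row ⟩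
    S + ⟦ Q a 0 ⟧ + 1                     ≡⟨ eq S ⟦ Q a 0 ⟧ ⟩
    (S + 1) + ⟦ Q a 0 ⟧                   ≤⟨ +-mono-≤ IH (⟦⟧-mono (λ q → proj₁ (UV ≤-refl z<s q))) ⟩
    (SU + SV) + ⟦ U a ⟧                   ≡⟨ eq′ SU SV ⟦ U a ⟧ ⟩
    (SU + ⟦ U a ⟧) + SV                   ∎
  where
  open ≤-Reasoning
  S = ∑ a (λ i → ∑ (1 + b) (λ j → ⟦ Q i j ⟧))
  SU = ∑ a (λ i → ⟦ U i ⟧)
  SV = ∑ (1 + b) (λ j → ⟦ V j ⟧)
  row : ∑ (1 + b) (λ j → ⟦ Q a j ⟧) ≡ ⟦ Q a 0 ⟧
  row = trans (∑-split 1 b _) (trans (cong (⟦ Q a 0 ⟧ +_) rowEq) (+-identityʳ _))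
  IH : S + 1 ≤ SU + SV
  IH = staircase a (suc b) Q U V anti (λ i<a → UV (m<n⇒m<1+n i<a)) ∃V
  eq : ∀ x y → x + y + 1 ≡ (x + 1) + y
  eq = solve-∀
  eq′ : ∀ x y z → (x + y) + z ≡ (x + z) + y
  eq′ = solve-∀
... | suc c = begin
    ∑ (1 + a) (λ i → ∑ (1 + b) (λ j → ⟦ Q i j ⟧)) + 1
      ≡⟨ cong (_+ 1) (trans (∑-cong (1 + a) (λ i _ → ∑-split 1 b _)) (∑-+ (1 + a) (λ i → ⟦ Q i 0 ⟧) _)) ⟩
    ∑ (1 + a) (λ i → ⟦ Q i 0 ⟧) + S + 1   ≡⟨ cong (λ c → c + S + 1) column ⟩
    ⟦ Q a 0 ⟧ + S + 1                     ≡⟨ +-assoc ⟦ Q a 0 ⟧ S 1 ⟩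
    ⟦ Q a 0 ⟧ + (S + 1)                   ≤⟨ +-mono-≤ (⟦⟧-mono (λ q → proj₂ (UV ≤-refl z<s q))) IH ⟩
    ⟦ V 0 ⟧ + (SU + SV)                   ≡⟨ eq ⟦ V 0 ⟧ SU SV ⟩
    SU + (⟦ V 0 ⟧ + SV)                   ≡⟨ cong (SU +_) (∑-split 1 b _) ⟨
    SU + ∑ (1 + b) (λ j → ⟦ V j ⟧)        ∎
  where
  open ≤-Reasoning
  S = ∑ (1 + a) (λ i → ∑ b (λ j → ⟦ Q i (1 + j) ⟧))
  SU = ∑ (1 + a) (λ i → ⟦ U i ⟧)
  SV = ∑ b (λ j → ⟦ V (1 + j) ⟧)
  cell : ∃[ j ] (j < b × Q a (1 + j) ≡ true)
  cell with j , j<b , q ← ∑-pos b _ (subst (0 <_) (sym rowEq) z<s) = j , j<b , ⟦⟧-pos q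
  column : ∑ (1 + a) (λ i → ⟦ Q i 0 ⟧) ≡ ⟦ Q a 0 ⟧
  column = cong (_+ ⟦ Q a 0 ⟧) (∑-zero a (λ i i<a → ⟦⟧-zero
    (λ q → contradiction (anti i<a q (proj₂ (proj₂ cell))) λ ())))
  IH : S + 1 ≤ SU + SV
  IH = staircase (suc a) b (λ i j → Q i (1 + j)) U (V ∘ suc)
    (λ i<i′ q q′ → ≤-pred (anti i<i′ q q′))
    (λ i<a j<b → UV i<a (s<s j<b))
    -- Once column 0 is removed, the cell found in row `a` supplies a member of `V` among the
    -- remaining columns.
    (let j , j<b , q = cell in j , j<b , proj₂ (UV ≤-refl (s<s j<b) q))
  eq : ∀ x y z → x + (y + z) ≡ y + (x + z)
  eq = solve-∀

-- Chains and the rank of a cell.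

infixl 5 _▻_
-- Chain P m i j: m pairs in P increasing strictly in both coordinates, with all first coordinates
-- below i and all second coordinates below j.
data Chain (P : ℕ → ℕ → Set) : ℕ → ℕ → ℕ → Set where
  []  : ∀ {i j} → Chain P 0 i j
  _▻_ : ∀ {m x y i j} → Chain P m x y → P x y × x < i × y < j → Chain P (suc m) i j

module _ {P : ℕ → ℕ → Set} where

  chain-weaken : ∀ {m i j i′ j′} → i ≤ i′ → j ≤ j′ → Chain P m i j → Chain P m i′ j′
  chain-weaken i≤i′ j≤j′ [] = []
  chain-weaken i≤i′ j≤j′ (c ▻ (p , x<i , y<j)) = c ▻ (p , <-≤-trans x<i i≤i′ , <-≤-trans y<j j≤j′)

  chain-rows : ∀ {m i j} → Chain P m i j → m ≤ i
  chain-rows [] = z≤n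
  chain-rows (c ▻ (_ , x<i , _)) = ≤-trans (s≤s (chain-rows c)) x<i

  -- The `m` second coordinates are distinct and lie in `[q, j)`. For crossing edges separated by
  -- `q` this pushes the right ends far to the right, hence makes the edges long.
  chain-cols : ∀ {q m i j} → q ≤ j → (∀ {x y} → P x y → q ≤ y) → Chain P m i j → q + m ≤ j
  chain-cols {q} q≤j q≤y [] = subst (_≤ _) (sym (+-identityʳ q)) q≤j
  chain-cols {q} q≤j q≤y (_▻_ {m} c (p , _ , y<j)) =
    ≤-trans (≤-reflexive (+-suc q m)) (≤-trans (s≤s (chain-cols (q≤y p) q≤y c)) y<j)

module Rank (P : ℕ → ℕ → Bool) where

  -- The length of the longest chain in P among the rows below i and the columns below j.
  rank : ℕ → ℕ → ℕ
  rank zero    _       = 0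
  rank (suc i) zero    = 0
  rank (suc i) (suc j) = rank i (suc j) ⊔ (rank (suc i) j ⊔ (if P i j then suc (rank i j) else 0))

  rank-stepˡ : ∀ i j → rank i j ≤ rank (suc i) j
  rank-stepˡ zero    zero    = z≤n
  rank-stepˡ (suc i) zero    = z≤n
  rank-stepˡ i       (suc j) = m≤m⊔n _ _

  rank-stepʳ : ∀ i j → rank i j ≤ rank i (suc j)
  rank-stepʳ zero    j = z≤n
  rank-stepʳ (suc i) j = ≤-trans (m≤m⊔n _ _) (m≤n⊔m (rank i (suc j)) _)

  rank-mono : ∀ {i j i′ j′} → i ≤′ i′ → j ≤′ j′ → rank i j ≤ rank i′ j′
  rank-mono ≤′-refl ≤′-refl = ≤-refl
  rank-mono {i} ≤′-refl (≤′-step {j} q) = ≤-trans (rank-mono {i} ≤′-refl q) (rank-stepʳ i j)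
  rank-mono {i} {j} {j′ = j′} (≤′-step {i′} p) q = ≤-trans (rank-mono {i} {j} p q) (rank-stepˡ i′ j′)

  rank-< : ∀ {i j i′ j′} → P i j ≡ true → i < i′ → j < j′ → rank i j < rank i′ j′
  rank-< {i} {j} Pij i<i′ j<j′ = ≤-trans step (rank-mono (≤⇒≤′ i<i′) (≤⇒≤′ j<j′))
    where
    step : suc (rank i j) ≤ rank (suc i) (suc j)
    step rewrite Pij = ≤-trans (m≤n⊔m (rank (suc i) j) _) (m≤n⊔m (rank i (suc j)) _)

  -- The recursion for `rank` is a maximum, so `r` lies below one of its three entries. Either the
  -- recursive call for a smaller corner finds the cell, or `r` equals `rank i j` and `(i , j)`
  -- itself is the cell.
  rank-witness : ∀ i j {r} → r < rank i j →
    ∃[ x ] ∃[ y ] (x < i × y < j × P x y ≡ true × rank x y ≡ r)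
  rank-witness (suc i) (suc j) {r} r<
    with r <? rank i (suc j)
  ... | yes p = let x , y , x<i , y<j , e = rank-witness i (suc j) p in x , y , m<n⇒m<1+n x<i , y<j , e
  ... | no ¬p with r <? rank (suc i) j
  ...   | yes p = let x , y , x<i , y<j , e = rank-witness (suc i) j p in x , y , x<i , m<n⇒m<1+n y<j , e
  ...   | no ¬q with P i j in Pij
  ...     | false = contradiction r< (≤⇒≯ (⊔-lub (≮⇒≥ ¬p) (⊔-lub (≮⇒≥ ¬q) z≤n)))
  ...     | true with r <? rank i j
  ...       | yes p = let x , y , x<i , y<j , e = rank-witness i j p in x , y , m<n⇒m<1+n x<i , m<n⇒m<1+n y<j , e
  ...       | no ¬s with r <? suc (rank i j)
  ...         | yes p = i , j , ≤-refl , ≤-refl , Pij , ≤-antisym (≮⇒≥ ¬s) (≤-pred p)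
  ...         | no ¬t = contradiction r< (≤⇒≯ (⊔-lub (≮⇒≥ ¬p) (⊔-lub (≮⇒≥ ¬q) (≮⇒≥ ¬t))))

  rank-chain : ∀ m {i j} → m ≤ rank i j → Chain (λ x y → P x y ≡ true) m i j
  rank-chain zero    _ = []
  rank-chain (suc m) {i} {j} p with x , y , x<i , y<j , Pxy , e ← rank-witness i j p =
    rank-chain m (≤-reflexive (sym e)) ▻ (Pxy , x<i , y<j)

  OfRank : ℕ → ℕ → ℕ → Set
  OfRank r i j = P i j ≡ true × rank i j ≡ r

  -- Crossings between the merged edges need not come from crossings of the edges themselves, but the
  -- row x can always be moved up to a row below h in which the crossing is genuine.
  lower-row : ∀ {r r′ h l x z} → OfRank r h l → OfRank r′ x z → r′ < r → x < h →
    ∃[ h′ ] ∃[ l′ ] (OfRank r′ h′ l′ × x ≤ h′ × h′ < h × l′ < l)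
  lower-row {r} {r′} {h} {l} {x} {z} (_ , refl) (Pxz , refl) r′<r x<h with z <? l
  ... | yes z<l = x , z , (Pxz , refl) , ≤-refl , x<h , z<l
  ... | no z≮l with h₁ , l₁ , h₁<h , l₁<l , P₁ , e ← rank-witness h l r′<r =
    h₁ , l₁ , (P₁ , e) ,
    ≮⇒≥ (λ h₁<x → <-irrefl e (rank-< P₁ h₁<x (<-≤-trans l₁<l (≮⇒≥ z≮l)))) , h₁<h , l₁<l

  -- The transpose of `lower-row`. If `h ≤ x`, a cell of rank `r′` below `(h , l)` cannot lie in a
  -- column before `z`: it would be strictly below `(x , z)` in both coordinates and give that cell
  -- a rank above `r′`.
  lower-col : ∀ {r r′ h l x z} → OfRank r h l → OfRank r′ x z → r′ < r → z < l →
    ∃[ h′ ] ∃[ l′ ] (OfRank r′ h′ l′ × h′ < h × z ≤ l′ × l′ < l)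
  lower-col {r} {r′} {h} {l} {x} {z} (_ , refl) (Pxz , refl) r′<r z<l with x <? h
  ... | yes x<h = x , z , (Pxz , refl) , x<h , ≤-refl , z<l
  ... | no x≮h with h₁ , l₁ , h₁<h , l₁<l , P₁ , e ← rank-witness h l r′<r =
    h₁ , l₁ , (P₁ , e) , h₁<h ,
    ≮⇒≥ (λ l₁<z → <-irrefl e (rank-< P₁ (<-≤-trans h₁<h (≮⇒≥ x≮h)) l₁<z)) , l₁<l

  ofRank : ℕ → ℕ → ℕ → Bool
  ofRank r i j = P i j ∧ (rank i j ≡ᵇ r)

  ofRank⇒ : ∀ {r i j} → ofRank r i j ≡ true → OfRank r i j
  ofRank⇒ {r} {i} {j} p = let p₁ , p₂ = ∧-true p in p₁ , ≡ᵇ⇒≡ (rank i j) r (≡⇒T p₂)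

  rank≤row : ∀ i j → rank i j ≤ i
  rank≤row i j = chain-rows (rank-chain _ {i} {j} ≤-refl)

  rank≤col : ∀ i j → rank i j ≤ j
  rank≤col i j = chain-cols z≤n (λ _ → z≤n) (rank-chain _ {i} {j} ≤-refl)

  -- The added cells i < r and j ≤ r stand for pairs that are too short to lie in κ + 1 pairwise
  -- crossing edges.
  rowMeets colMeets : ℕ → ℕ → ℕ → Bool
  rowMeets b r i = (i <ᵇ r) ∨ some b (ofRank r i)
  colMeets a r j = (j <ᵇ suc r) ∨ some a (λ i → ofRank r i j)

  -- Cells of rank `r` lie in rows and columns from `r` on, and there they form a staircase, since
  -- of two increasing cells the upper one has larger rank. The term `1 + (r + r)` consists of the
  -- `r` added rows, the first `r` added columns, and the surplus 1 of `staircase`, for which the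
  -- added column `r` is the required member of `V`.
  ofRank-count : ∀ a b r → r ≤ a → r < b →
    ∑ a (λ i → ∑ b (λ j → ⟦ ofRank r i j ⟧)) + (1 + (r + r)) ≤
    ∑ a (λ i → ⟦ rowMeets b r i ⟧) + ∑ b (λ j → ⟦ colMeets a r j ⟧)
  ofRank-count a b r r≤a r<b
    with a′ , refl ← m≤n⇒∃[o]m+o≡n r≤a
    with b′ , refl ← m≤n⇒∃[o]m+o≡n (<⇒≤ r<b) = begin
      ∑ (r + a′) (λ i → ∑ (r + b′) (λ j → ⟦ ofRank r i j ⟧)) + (1 + (r + r))
        ≡⟨ cong (_+ (1 + (r + r))) (trans (∑-split r a′ _) (cong₂ _+_
             (∑-zero r (λ i i<r → ∑-zero (r + b′) (λ j _ → ⟦⟧-zero (row-low i<r))))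
             (∑-cong a′ (λ i _ → trans (∑-split r b′ _) (cong (_+ ∑ b′ (λ j → ⟦ ofRank r (r + i) (r + j) ⟧)) (∑-zero r (λ j j<r → ⟦⟧-zero (col-low j<r)))))))) ⟩
      S + (1 + (r + r))       ≡⟨ eq S r ⟩
      (r + r) + (S + 1)       ≤⟨ +-monoʳ-≤ (r + r) main ⟩
      (r + r) + (SU + SV)     ≡⟨ eq′ r SU SV ⟩
      (r + SU) + (r + SV)     ≡⟨ cong₂ _+_ (sym rowSum) (sym colSum) ⟩
      ∑ (r + a′) (λ i → ⟦ U i ⟧) + ∑ (r + b′) (λ j → ⟦ V j ⟧) ∎
    where
    open ≤-Reasoning
    U = rowMeets (r + b′) r
    V = colMeets (r + a′) r
    S = ∑ a′ (λ i → ∑ b′ (λ j → ⟦ ofRank r (r + i) (r + j) ⟧))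
    SU = ∑ a′ (λ i → ⟦ U (r + i) ⟧)
    SV = ∑ b′ (λ j → ⟦ V (r + j) ⟧)
    row-low : ∀ {i j} → i < r → ¬ (ofRank r i j ≡ true)
    row-low {i} {j} i<r p with _ , refl ← ofRank⇒ p = <⇒≱ i<r (rank≤row i j)
    col-low : ∀ {i j} → j < r → ¬ (ofRank r i j ≡ true)
    col-low {i} {j} j<r p with _ , refl ← ofRank⇒ p = <⇒≱ j<r (rank≤col i j)
    ones : ∀ (W : ℕ → Bool) → (∀ {i} → i < r → W i ≡ true) → ∑ r (λ i → ⟦ W i ⟧) ≡ r
    ones W w = trans (∑-cong r (λ i i<r → cong ⟦_⟧ (w i<r))) (trans (∑-const r 1) (*-identityʳ r))
    rowSum : ∑ (r + a′) (λ i → ⟦ U i ⟧) ≡ r + SU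
    rowSum = trans (∑-split r a′ _) (cong (_+ SU) (ones U (λ i<r → ∨-introˡ (<⇒<ᵇ≡ i<r))))
    colSum : ∑ (r + b′) (λ j → ⟦ V j ⟧) ≡ r + SV
    colSum = trans (∑-split r b′ _) (cong (_+ SV) (ones V (λ j<r → ∨-introˡ (<⇒<ᵇ≡ (m<n⇒m<1+n j<r)))))
    main : S + 1 ≤ SU + SV
    main = staircase a′ b′ (λ i j → ofRank r (r + i) (r + j)) (λ i → U (r + i)) (λ j → V (r + j))
      (λ {i} {j} {i′} {j′} i<i′ p p′ → let P₁ , e₁ = ofRank⇒ p ; P₂ , e₂ = ofRank⇒ p′ in
         ≮⇒≥ (λ j<j′ → <-irrefl (trans e₁ (sym e₂)) (rank-< P₁ (+-monoʳ-< r i<i′) (+-monoʳ-< r j<j′))))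
      (λ {i} {j} i<a j<b p → ∨-introʳ {(r + i) <ᵇ r} (some-intro (r + b′) (ofRank r (r + i)) (+-monoʳ-< r j<b) p) ,
                             ∨-introʳ {(r + j) <ᵇ suc r} (some-intro (r + a′) (λ i → ofRank r i (r + j)) (+-monoʳ-< r i<a) p))
      (0 , +-cancelˡ-< r 0 b′ (subst (_< r + b′) (sym (+-identityʳ r)) r<b) ,
       ∨-introˡ (<⇒<ᵇ≡ (s≤s (≤-reflexive (+-identityʳ r)))))
    eq : ∀ s r → s + (1 + (r + r)) ≡ (r + r) + (s + 1)
    eq = solve-∀
    eq′ : ∀ r u v → (r + r) + (u + v) ≡ (r + u) + (r + v)
    eq′ = solve-∀

  -- Every cell has one of the ranks `r < s`, so `ofRank-count` is summed over them; the odd numbers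
  -- `1 + (r + r)` add up to `s * s`.
  rank-count : ∀ a b s → s ≤ a → s ≤ b →
    (∀ {i j} → i < a → j < b → P i j ≡ true → rank i j < s) →
    ∑ b (λ j → ∑ a (λ i → ⟦ P i j ⟧)) + s * s ≤
    ∑ s (λ r → ∑ a (λ i → ⟦ rowMeets b r i ⟧)) + ∑ b (λ j → ∑ s (λ r → ⟦ colMeets a r j ⟧))
  rank-count a b s s≤a s≤b rank<s = begin
    ∑ b (λ j → ∑ a (λ i → ⟦ P i j ⟧)) + s * s
      ≤⟨ +-monoˡ-≤ (s * s) (∑-mono b (λ j j<b → ∑-mono a (λ i i<a → cell i<a j<b))) ⟩
    ∑ b (λ j → ∑ a (λ i → ∑ s (λ r → ⟦ ofRank r i j ⟧))) + s * s
      ≡⟨ cong₂ _+_ reorder (sym odds) ⟩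
    ∑ s (λ r → ∑ a (λ i → ∑ b (λ j → ⟦ ofRank r i j ⟧))) + ∑ s (λ r → 1 + (r + r))
      ≡⟨ ∑-+ s _ _ ⟨
    ∑ s (λ r → ∑ a (λ i → ∑ b (λ j → ⟦ ofRank r i j ⟧)) + (1 + (r + r)))
      ≤⟨ ∑-mono s (λ r r<s → ofRank-count a b r (≤-trans (<⇒≤ r<s) s≤a) (<-≤-trans r<s s≤b)) ⟩
    ∑ s (λ r → ∑ a (λ i → ⟦ rowMeets b r i ⟧) + ∑ b (λ j → ⟦ colMeets a r j ⟧))
      ≡⟨ ∑-+ s _ _ ⟩
    ∑ s (λ r → ∑ a (λ i → ⟦ rowMeets b r i ⟧)) + ∑ s (λ r → ∑ b (λ j → ⟦ colMeets a r j ⟧))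
      ≡⟨ cong (∑ s (λ r → ∑ a (λ i → ⟦ rowMeets b r i ⟧)) +_) (∑-swap s b _) ⟩
    ∑ s (λ r → ∑ a (λ i → ⟦ rowMeets b r i ⟧)) + ∑ b (λ j → ∑ s (λ r → ⟦ colMeets a r j ⟧)) ∎
    where
    open ≤-Reasoning
    cell : ∀ {i j} → i < a → j < b → ⟦ P i j ⟧ ≤ ∑ s (λ r → ⟦ ofRank r i j ⟧)
    cell {i} {j} i<a j<b with P i j in Pij
    ... | false = z≤n
    ... | true  = ≤-trans (subst (λ v → 1 ≤ ⟦ v ⟧) (sym (T⇒≡ (≡⇒≡ᵇ (rank i j) (rank i j) refl))) ≤-refl)
                    (term≤∑ s (λ r → ⟦ rank i j ≡ᵇ r ⟧) (rank<s i<a j<b Pij))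
    reorder : ∑ b (λ j → ∑ a (λ i → ∑ s (λ r → ⟦ ofRank r i j ⟧))) ≡
              ∑ s (λ r → ∑ a (λ i → ∑ b (λ j → ⟦ ofRank r i j ⟧)))
    reorder = trans (∑-cong b (λ j _ → ∑-swap a s _))
      (trans (∑-swap b s _) (∑-cong s (λ r _ → ∑-swap b a _)))
    odds : ∑ s (λ r → 1 + (r + r)) ≡ s * s
    odds = trans (∑-cong s (λ r _ → cong (λ t → 1 + (r + t)) (sym (+-identityʳ r))))
      (trans (eq s) (∑-id s))
      where
      eq : ∀ s → ∑ s (λ r → 1 + 2 * r) ≡ 2 * ∑ s (λ r → r) + s
      eq zero    = refl
      eq (suc s) = trans (cong (_+ (1 + 2 * s)) (eq s)) (eq′ (∑ s (λ r → r)) s)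
        where
        eq′ : ∀ t s → 2 * t + s + (1 + 2 * s) ≡ 2 * (t + s) + (1 + s)
        eq′ = solve-∀

-- Crossing edges, and the two graphs obtained by cutting at an edge 0y.

Graph : Set
Graph = ℕ → ℕ → Bool

edges : ℕ → Graph → ℕ
edges n G = ∑ n (λ j → ∑ j (λ i → ⟦ G i j ⟧))

-- Only the right end is compared with `q`; the left ends are kept below `q` by the row bound of the
-- chain.
EdgeAbove : Graph → ℕ → ℕ → ℕ → Set
EdgeAbove G q x y = G x y ≡ true × q ≤ y

-- k edges cross pairwise iff they form a chain and some q separates their left ends from their
-- right ends.
Crossings : Graph → ℕ → ℕ → Set
Crossings G k n = ∃[ q ] Chain (EdgeAbove G q) k q n

-- With `y = suc m`, this sorts the left neighbours of a vertex beyond `y` into 0, the `m` vertices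
-- between 0 and `y`, and those from `y` on.
∑-ends : ∀ m j f → ∑ (suc (suc m) + j) f ≡ f 0 + (∑ m (λ i → f (1 + i)) + ∑ (1 + j) (λ i → f (suc m + i)))
∑-ends m j f = trans (cong (λ t → ∑ (suc t) f) (sym (+-suc m j)))
  (trans (∑-split 1 (m + suc j) f) (cong (f 0 +_) (∑-split m (suc j) (λ i → f (1 + i)))))

-- Here `y = suc a`, with `a` vertices between 0 and `y` and `b` vertices beyond `y`, and κ is
-- `1 + s`. `P` is the matrix of the edges crossing 0y.
module Split (G : Graph) (a b s : ℕ) (s<a : s < a) (s<b : s < b)
  (G₀ : G 0 (suc a) ≡ true) (free : ¬ Crossings G (2 + s) (2 + a + b)) where

  P : ℕ → ℕ → Bool
  P i j = G (suc i) (2 + a + j)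

  open Rank P

  -- A chain of `s` cells below `(i , j)`, with the edge 0y put underneath and `(i , j)` on top,
  -- would be `2 + s` crossing edges separated by `suc a`.
  rank<s : ∀ {i j} → i < a → j < b → P i j ≡ true → rank i j < s
  rank<s {i} {j} i<a j<b Pij = ≰⇒> λ s≤rank → free (suc a ,
      over (rank-chain s s≤rank) ▻ ((Pij , above j) , s<s i<a , +-monoʳ-< (2 + a) j<b))
    where
    above : ∀ l → suc a ≤ 2 + a + l
    above l = ≤-trans (n≤1+n (suc a)) (m≤m+n (2 + a) l)
    over : ∀ {m i j} → Chain (λ x y → P x y ≡ true) m i j →
      Chain (EdgeAbove G (suc a)) (suc m) (suc i) (2 + a + j)
    over [] = [] ▻ ((G₀ , ≤-refl) , z<s , m≤m+n _ _)
    over (c ▻ (p , x<i , y<j)) = over c ▻ ((p , above _) , s<s x<i , +-monoʳ-< (2 + a) y<j)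

  -- The vertex 2 + a + r of `left` and the vertex 1 + r of `right` (r < s) collect the edges of rank r.
  toLeft : ℕ → ℕ → Bool
  toLeft zero    r = true
  toLeft (suc i) r = if i <ᵇ a then rowMeets b r i else true

  left : Graph
  left x z = if z <ᵇ (2 + a) then G x z else toLeft x (z ∸ (2 + a))

  left-in : ∀ x {z} → z < 2 + a → left x z ≡ G x z
  left-in x {z} z< rewrite <⇒<ᵇ≡ z< = refl

  left-out : ∀ x r → left x (2 + a + r) ≡ toLeft x r
  left-out x r rewrite ≥⇒<ᵇ≡ (m≤m+n (2 + a) r) | m+n∸m≡n (2 + a) r = refl

  -- The vertex `suc s + x` of `right` stands for `suc a + x` in `G`, so `y` becomes `suc s`. Edges
  -- from 0 and from `y` on are copied.
  toRight : ℕ → ℕ → Bool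
  toRight zero    j = G 0 (2 + a + j)
  toRight (suc r) j = if r <ᵇ s then colMeets a r j else G (suc a + (r ∸ s)) (2 + a + j)

  right : Graph
  right x z = if z <ᵇ (2 + s) then true else toRight x (z ∸ (2 + s))

  right-in : ∀ x {z} → z < 2 + s → right x z ≡ true
  right-in x {z} z< rewrite <⇒<ᵇ≡ z< = refl

  right-out : ∀ x j → right x (2 + s + j) ≡ toRight x j
  right-out x j rewrite ≥⇒<ᵇ≡ (m≤m+n (2 + s) j) | m+n∸m≡n (2 + s) j = refl

  X XA XB R₀ R₁ : ℕ
  X  = ∑ b (λ j → ∑ a (λ i → ⟦ P i j ⟧))
  XA = ∑ s (λ r → ∑ a (λ i → ⟦ rowMeets b r i ⟧))
  XB = ∑ b (λ j → ∑ s (λ r → ⟦ colMeets a r j ⟧))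
  R₀ = ∑ b (λ j → ⟦ G 0 (2 + a + j) ⟧)
  R₁ = ∑ b (λ j → ∑ (1 + j) (λ i → ⟦ G (suc a + i) (2 + a + j) ⟧))

  ∑-+₃ : ∀ n f g h → ∑ n (λ i → f i + (g i + h i)) ≡ ∑ n f + (∑ n g + ∑ n h)
  ∑-+₃ n f g h = trans (∑-+ n f _) (cong (∑ n f +_) (∑-+ n g h))

  edges-G : edges (2 + a + b) G ≡ edges (2 + a) G + (R₀ + (X + R₁))
  edges-G = trans (∑-split (2 + a) b _) (cong (edges (2 + a) G +_)
    (trans (∑-cong b (λ j _ → ∑-ends a j _)) (∑-+₃ b _ _ _)))

  edges-left : edges (2 + a + s) left ≡ edges (2 + a) G + (s * 1 + (XA + ∑ s (λ r → 1 + r)))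
  edges-left = trans (∑-split (2 + a) s _) (cong₂ _+_
    (∑-cong (2 + a) (λ z z< → ∑-cong z (λ x _ → cong ⟦_⟧ (left-in x z<))))
    (trans (∑-cong s (λ r _ → trans (∑-cong (2 + a + r) (λ x _ → cong ⟦_⟧ (left-out x r)))
        (trans (∑-ends a r (λ x → ⟦ toLeft x r ⟧)) (cong (1 +_) (cong₂ _+_ (mid r) (last r))))))
      (trans (∑-+₃ s (λ _ → 1) _ _) (cong (_+ (XA + ∑ s (λ r → 1 + r))) (∑-const s 1)))))
    where
    mid : ∀ r → ∑ a (λ i → ⟦ toLeft (1 + i) r ⟧) ≡ ∑ a (λ i → ⟦ rowMeets b r i ⟧)
    mid r = ∑-cong a λ i i<a → cong (λ c → ⟦ if c then rowMeets b r i else true ⟧) (<⇒<ᵇ≡ i<a)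
    last : ∀ r → ∑ (1 + r) (λ i → ⟦ toLeft (suc a + i) r ⟧) ≡ 1 + r
    last r = trans (∑-cong (1 + r) (λ i _ →
        cong (λ c → ⟦ if c then rowMeets b r (a + i) else true ⟧) (≥⇒<ᵇ≡ (m≤m+n a i))))
      (trans (∑-const (1 + r) 1) (*-identityʳ (1 + r)))

  edges-right : edges (2 + s + b) right ≡ ∑ (2 + s) (λ z → z) + (R₀ + (XB + R₁))
  edges-right = trans (∑-split (2 + s) b _) (cong₂ _+_
    (∑-cong (2 + s) (λ z z< → trans (∑-cong z (λ x _ → cong ⟦_⟧ (right-in x z<)))
      (trans (∑-const z 1) (*-identityʳ z))))
    (trans (∑-cong b (λ j _ → trans (∑-cong (2 + s + j) (λ x _ → cong ⟦_⟧ (right-out x j)))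
        (trans (∑-ends s j (λ x → ⟦ toRight x j ⟧)) (cong (⟦ G 0 (2 + a + j) ⟧ +_) (cong₂ _+_ (mid j) (last j))))))
      (∑-+₃ b _ _ _)))
    where
    pick : ∀ r j → Bool → Bool
    pick r j c = if c then colMeets a r j else G (suc a + (r ∸ s)) (2 + a + j)
    mid : ∀ j → ∑ s (λ r → ⟦ toRight (1 + r) j ⟧) ≡ ∑ s (λ r → ⟦ colMeets a r j ⟧)
    mid j = ∑-cong s λ r r<s → cong (λ c → ⟦ pick r j c ⟧) (<⇒<ᵇ≡ r<s)
    last : ∀ j → ∑ (1 + j) (λ i → ⟦ toRight (suc s + i) j ⟧) ≡ ∑ (1 + j) (λ i → ⟦ G (suc a + i) (2 + a + j) ⟧)
    last j = ∑-cong (1 + j) λ i _ → trans (cong (λ c → ⟦ pick (s + i) j c ⟧) (≥⇒<ᵇ≡ (m≤m+n s i)))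
      (cong (λ t → ⟦ G (suc a + t) (2 + a + j) ⟧) (m+n∸m≡n s i))

  -- Of the constant, `s * s` is the gain in `rank-count`. The remaining `1 + 3 * s + s * s` counts
  -- the pairs filled in outright: in `left` those joining a new vertex to 0, to `y` or to another
  -- new vertex, in `right` all pairs among 0, the new vertices and `y`.
  edges-split : edges (2 + a + b) G + (1 + s) * (1 + 2 * s) ≤ edges (2 + a + s) left + edges (2 + s + b) right
  edges-split = begin
    edges (2 + a + b) G + (1 + s) * (1 + 2 * s)
      ≡⟨ cong (_+ (1 + s) * (1 + 2 * s)) edges-G ⟩
    E₀ + (R₀ + (X + R₁)) + (1 + s) * (1 + 2 * s)
      ≡⟨ eq₁ E₀ R₀ X R₁ s ⟩
    (X + s * s) + (E₀ + R₀ + R₁ + 1 + 3 * s + s * s)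
      ≤⟨ +-monoˡ-≤ _ (rank-count a b s (<⇒≤ s<a) (<⇒≤ s<b) rank<s) ⟩
    (XA + XB) + (E₀ + R₀ + R₁ + 1 + 3 * s + s * s)
      ≡⟨ cong (λ t → (XA + XB) + (E₀ + R₀ + R₁ + 1 + 3 * s + t)) (sym (∑-id s)) ⟩
    (XA + XB) + (E₀ + R₀ + R₁ + 1 + 3 * s + (2 * t + s))
      ≡⟨ eq₂ XA XB E₀ R₀ R₁ s t ⟩
    (E₀ + (s * 1 + (XA + (s * 1 + t)))) + (t + s + (1 + s) + (R₀ + (XB + R₁)))
      ≡⟨ cong (λ w → (E₀ + (s * 1 + (XA + w))) + (t + s + (1 + s) + (R₀ + (XB + R₁))))
           (trans (cong (_+ t) (sym (∑-const s 1))) (sym (∑-+ s (λ _ → 1) (λ r → r)))) ⟩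
    (E₀ + (s * 1 + (XA + ∑ s (λ r → 1 + r)))) + (∑ (2 + s) (λ z → z) + (R₀ + (XB + R₁)))
      ≡⟨ cong₂ _+_ edges-left edges-right ⟨
    edges (2 + a + s) left + edges (2 + s + b) right ∎
    where
    open ≤-Reasoning
    E₀ = edges (2 + a) G
    t = ∑ s (λ r → r)
    eq₁ : ∀ e r x q s → e + (r + (x + q)) + (1 + s) * (1 + 2 * s) ≡ (x + s * s) + (e + r + q + 1 + 3 * s + s * s)
    eq₁ = solve-∀
    eq₂ : ∀ xa xb e r q s t → (xa + xb) + (e + r + q + 1 + 3 * s + (2 * t + s)) ≡
      (e + (s * 1 + (xa + (s * 1 + t)))) + (t + s + (1 + s) + (r + (xb + q)))
    eq₂ = solve-∀

  -- Crossing edges of `left` become crossing edges of `G` with the same separator, rewritten from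
  -- the top edge down. Edges ending at or before `y` are kept; one ending in a new vertex is
  -- replaced by an edge of that rank. `lower-row` never moves the left end down, so the rest of the
  -- chain still fits below it.
  module LiftLeft (q : ℕ) (q≤a : q ≤ a) where

    q≤ : ∀ l → q ≤ 2 + a + l
    q≤ l = ≤-trans q≤a (≤-trans (m≤n+m a 2) (m≤m+n (2 + a) l))

    inside : ∀ {m i j} → j ≤ 2 + a → Chain (EdgeAbove left q) m i j → Chain (EdgeAbove G q) m i j
    inside j≤ [] = []
    inside j≤ (_▻_ {x = x} c ((e , q≤z) , x<i , z<j)) =
      inside (≤-trans (<⇒≤ z<j) j≤) c ▻
      ((trans (sym (left-in x (<-≤-trans z<j j≤))) e , q≤z) , x<i , z<j)

    -- The hypothesis is the invariant of the descent: an edge with `m` edges below it, in a chain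
    -- of `2 + s` whose right ends are below `2 + a + s`, must leave room for the right ends above
    -- its own.
    short : ∀ {m r} → 2 + a + r + (2 + s) ≤ 2 + a + s + m → 2 + r ≤ m
    short {m} {r} inv = +-cancelˡ-≤ (2 + a + s) (2 + r) m (subst (_≤ 2 + a + s + m) (eq r s a) inv)
      where
      eq : ∀ r s a → 2 + a + r + (2 + s) ≡ 2 + a + s + (2 + r)
      eq = solve-∀

    -- The edge is not one of the filled-in pairs. Since `2 + r ≤ m ≤ x`, its left end is neither 0
    -- nor in an added row `i < r`; since `x < q ≤ a`, it comes before `y`.
    real : ∀ {m x r} → left x (2 + a + r) ≡ true → 2 + a + r + (2 + s) ≤ 2 + a + s + m → m ≤ x → x < q →
      ∃[ i ] ∃[ j ] (x ≡ suc i × j < b × OfRank r i j)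
    real {x = zero} e inv m≤x x<q = contradiction (≤-trans (short inv) m≤x) λ ()
    real {x = suc i} {r} e inv m≤x x<q
      with meets ← trans (sym (left-out (suc i) r)) e
      rewrite <⇒<ᵇ≡ (<-≤-trans (<-trans (n<1+n i) x<q) q≤a)
      with ∨-true {i <ᵇ r} meets
    ... | inj₁ i<r = contradiction (<ᵇ≡⇒< i<r)
            (≤⇒≯ (≤-trans (n≤1+n r) (≤-pred (≤-trans (short inv) m≤x))))
    ... | inj₂ p = let j , j<b , o = some-elim b _ p in i , j , refl , j<b , ofRank⇒ o

    descend : ∀ {z j m} → z < j → j + (2 + s) ≤ 2 + a + s + suc m → z + (2 + s) ≤ 2 + a + s + m
    descend {z} {j} {m} z<j p = ≤-pred (≤-trans (+-monoˡ-≤ (2 + s) z<j) (≤-trans p (≤-reflexive (+-suc (2 + a + s) m))))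

    lift : ∀ {m i r h l} → Chain (EdgeAbove left q) m i (2 + a + r) → 2 + a + r + (2 + s) ≤ 2 + a + s + m →
      i ≤ q → OfRank r h l → i ≤ suc h → Chain (EdgeAbove G q) m (suc h) (2 + a + l)
    lift [] inv i≤q o i≤h = []
    lift {l = l} (_▻_ {m} {x} {z} c ((e , q≤z) , x<i , z<j)) inv i≤q o i≤h with z <? 2 + a
    ... | yes z< = inside (<⇒≤ z<) c ▻
      ((trans (sym (left-in x z<)) e , q≤z) , <-≤-trans x<i i≤h , <-≤-trans z< (m≤m+n _ l))
    ... | no z≮ with r′ , refl ← m≤n⇒∃[o]m+o≡n (≮⇒≥ z≮)
        with i′ , j′ , refl , _ , o′ ← real e (descend z<j inv) (chain-rows c) (<-≤-trans x<i i≤q)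
        with h′ , l′ , o″ , x≤h′ , h′<h , l′<l ←
          lower-row o o′ (+-cancelˡ-< (2 + a) r′ _ z<j) (≤-pred (<-≤-trans x<i i≤h)) =
      lift c (descend z<j inv) (≤-trans (<⇒≤ x<i) i≤q) o″ (s≤s x≤h′) ▻
        ((proj₁ o″ , q≤ l′) , s<s h′<h , +-monoʳ-< (2 + a) l′<l)

    top : Chain (EdgeAbove left q) (2 + s) q (2 + a + s) → Crossings G (2 + s) (2 + a + b)
    top (_▻_ {m} {x} {z} c ((e , q≤z) , x<q , z<j)) with z <? 2 + a
    ... | yes z< = q , inside (<⇒≤ z<) c ▻
      ((trans (sym (left-in x z<)) e , q≤z) , x<q , <-≤-trans z< (m≤m+n _ b))
    ... | no z≮ with r , refl ← m≤n⇒∃[o]m+o≡n (≮⇒≥ z≮)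
        with i , j , refl , j<b , o ← real e (descend z<j ≤-refl) (chain-rows c) x<q =
      q , lift c (descend z<j ≤-refl) (<⇒≤ x<q) o ≤-refl ▻ ((proj₁ o , q≤ j) , x<q , +-monoʳ-< (2 + a) j<b)

  left-free : ¬ Crossings left (2 + s) (2 + a + s)
  left-free (q , c@(_ ▻ ((_ , q≤z) , _ , z<j))) = free (LiftLeft.top q q≤a c)
    where
    eq : ∀ a s → 2 + a + s ≡ a + (2 + s)
    eq = solve-∀
    q≤a : q ≤ a
    -- All `2 + s` right ends have to fit between `q` and `2 + a + s`.
    q≤a = +-cancelʳ-≤ (2 + s) q a (subst (q + (2 + s) ≤_) (eq a s)
      (chain-cols (≤-trans q≤z (<⇒≤ z<j)) proj₂ c))

  -- The `2 + s` left ends lie below the separator, so it has the form `2 + s + p`; in `G` it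
  -- becomes `2 + a + p`. Going down the chain, `lift` copies edges whose left end is `y` or later,
  -- and `liftRanked` takes over below the first edge that leaves a new vertex.
  module LiftRight (p : ℕ) where

    q : ℕ
    q = 2 + s + p

    LiftedEdge : ℕ → ℕ → Set
    LiftedEdge = EdgeAbove G (2 + a + p)

    data View : ℕ → ℕ → Set where
      origin : ∀ {j} → G 0 (2 + a + j) ≡ true → View 0 j
      ranked : ∀ {r i j} → r < s → i < a → OfRank r i j → View (suc r) j
      inner  : ∀ {x j} → G (suc a + x) (2 + a + j) ≡ true → View (suc s + x) j

    view : ∀ {x j} → right x (2 + s + j) ≡ true → x ≤ j → View x j
    view {zero} {j} e _ = origin (trans (sym (right-out 0 j)) e)
    view {suc r} {j} e r<j with e′ ← trans (sym (right-out (suc r) j)) e with r <? s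
    ... | yes r<s rewrite <⇒<ᵇ≡ r<s with ∨-true {j <ᵇ suc r} e′
    ...   | inj₁ j≤r = contradiction (<ᵇ≡⇒< j≤r) (≤⇒≯ r<j)
    ...   | inj₂ m = let i , i<a , o = some-elim a _ m in ranked r<s i<a (ofRank⇒ o)
    view {suc r} {j} e r<j | no r≮s with x , refl ← m≤n⇒∃[o]m+o≡n (≮⇒≥ r≮s)
      rewrite ≥⇒<ᵇ≡ (m≤m+n s x) | m+n∸m≡n s x = inner e′

    descend : ∀ {x i m} → x < i → i + (2 + s) ≤ q + suc m → x + (2 + s) ≤ q + m
    descend {x} {i} {m} x<i inv = ≤-pred (≤-trans (+-monoˡ-≤ (2 + s) x<i) (≤-trans inv (≤-reflexive (+-suc q m))))

    -- The condition on `x` says that the left ends of the edges higher in the chain fit between `x`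
    -- and `q`. Together with the `m` right ends between `q` and `z` the edge spans at least
    -- `2 + s`. The resulting `x ≤ j` is what excludes the added cells `j ≤ r` in `view`.
    length : ∀ {m x z} → Chain (EdgeAbove right q) m x z → q ≤ z → x + (2 + s) ≤ q + m →
      ∃[ j ] (z ≡ 2 + s + j × x ≤ j × p ≤ j)
    length {m} {x} {z} c q≤z inv with j , refl ← m≤n⇒∃[o]m+o≡n (≤-trans (m≤m+n (2 + s) p) q≤z) =
      j , refl ,
      +-cancelˡ-≤ (2 + s) x j (≤-trans (≤-reflexive (+-comm (2 + s) x)) (≤-trans inv (chain-cols q≤z proj₂ c))) ,
      +-cancelˡ-≤ (2 + s) p j q≤z

    bottom : ∀ {m z i j} → Chain (EdgeAbove right q) m 0 z → LiftedEdge 0 j → 0 < i → ∀ {j′} → j < j′ → Chain LiftedEdge (suc m) i j′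
    bottom [] e 0<i j<j′ = [] ▻ (e , 0<i , j<j′)
    bottom (_ ▻ (_ , () , _)) _ _ _

    -- Below an edge from a new vertex, the left ends are new vertices of smaller rank or 0.
    -- `lower-col` moves right ends only upwards, so they remain above the separator.
    liftRanked : ∀ {m r k h l} → Chain (EdgeAbove right q) m (suc r) (2 + s + k) → r < s →
      suc r + (2 + s) ≤ q + m → OfRank r h l → k ≤ l → Chain LiftedEdge m (suc h) (2 + a + l)
    liftRanked [] r<s inv o k≤l = []
    liftRanked {l = l} (_▻_ {m} {x} {z} c ((e , q≤z) , x<i , z<k)) r<s inv o k≤l
      with j , refl , x≤j , p≤j ← length c q≤z (descend x<i inv)
      with j<l ← <-≤-trans (+-cancelˡ-< (2 + s) j _ z<k) k≤l
      with view {x} {j} e x≤j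
    ... | origin g = bottom c (g , +-monoʳ-≤ (2 + a) p≤j) z<s (+-monoʳ-< (2 + a) j<l)
    ... | inner g = contradiction (≤-pred x<i) (≤⇒≯ (≤-trans (<⇒≤ r<s) (m≤m+n s _)))
    ... | ranked r′<s _ o′
        with h′ , l′ , o″ , h′<h , j≤l′ , l′<l ← lower-col o o′ (≤-pred x<i) j<l =
      liftRanked c r′<s (descend x<i inv) o″ j≤l′ ▻
        ((proj₁ o″ , +-monoʳ-≤ (2 + a) (≤-trans p≤j j≤l′)) , s<s h′<h , +-monoʳ-< (2 + a) l′<l)

    lift : ∀ {m i k} → Chain (EdgeAbove right q) m (suc s + i) (2 + s + k) →
      suc s + i + (2 + s) ≤ q + m → Chain LiftedEdge m (suc a + i) (2 + a + k)
    lift [] inv = []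
    lift {i = i} (_▻_ {m} {x} {z} c ((e , q≤z) , x<i , z<k)) inv
      with j , refl , x≤j , p≤j ← length c q≤z (descend x<i inv)
      with j<k ← +-monoʳ-< (2 + a) (+-cancelˡ-< (2 + s) j _ z<k)
      with view {x} {j} e x≤j
    ... | origin g = bottom c (g , +-monoʳ-≤ (2 + a) p≤j) z<s j<k
    ... | inner {x′} g = lift c (descend x<i inv) ▻
        ((g , +-monoʳ-≤ (2 + a) p≤j) , +-monoʳ-< (suc a) (+-cancelˡ-< (suc s) x′ i x<i) , j<k)
    ... | ranked {i = h} r<s h<a o = liftRanked c r<s (descend x<i inv) o ≤-refl ▻
        ((proj₁ o , +-monoʳ-≤ (2 + a) p≤j) , <-≤-trans (s<s h<a) (m≤m+n (suc a) i) , j<k)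

    top : Chain (EdgeAbove right q) (2 + s) q (2 + s + b) → Crossings G (2 + s) (2 + a + b)
    top c = 2 + a + p , subst (λ i → Chain LiftedEdge (2 + s) i (2 + a + b)) (cong suc (+-suc a p))
      (lift (subst (λ i → Chain (EdgeAbove right q) (2 + s) i (2 + s + b)) (sym (cong suc (+-suc s p))) c)
        (≤-reflexive (cong (_+ (2 + s)) (cong suc (+-suc s p)))))

  right-free : ¬ Crossings right (2 + s) (2 + s + b)
  right-free (q , c) with p , refl ← m≤n⇒∃[o]m+o≡n (chain-rows c) = free (LiftRight.top p c)

-- The Capoyleas-Pach bound.

Bound : ℕ → ℕ → ℕ → Set
Bound κ n e = e + κ * (1 + 2 * κ) ≤ 2 * κ * n

∑-⟦⟧≤ : ∀ n (p : ℕ → Bool) → ∑ n (λ i → ⟦ p i ⟧) ≤ n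
∑-⟦⟧≤ n p = ≤-trans (∑-mono n (λ i _ → ⟦⟧≤1 (p i))) (≤-reflexive (trans (∑-const n 1) (*-identityʳ n)))

∑-id-odd : ∀ κ → ∑ (1 + 2 * κ) (λ j → j) ≡ κ * (1 + 2 * κ)
∑-id-odd κ = *-cancelˡ-≡ _ _ 2 (+-cancelʳ-≡ (1 + 2 * κ) _ _ (trans (∑-id (1 + 2 * κ)) (eq κ)))
  where
  eq : ∀ κ → (1 + 2 * κ) * (1 + 2 * κ) ≡ 2 * (κ * (1 + 2 * κ)) + (1 + 2 * κ)
  eq = solve-∀

-- On `1 + 2 * κ` vertices the bound equals the number of all pairs; this is the base of the
-- induction.
edges-complete : ∀ κ G → Bound κ (1 + 2 * κ) (edges (1 + 2 * κ) G)
edges-complete κ G = begin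
  edges n G + κ * n               ≤⟨ +-monoˡ-≤ (κ * n) (∑-mono n (λ j _ → ∑-⟦⟧≤ j (λ i → G i j))) ⟩
  ∑ n (λ j → j) + κ * n           ≡⟨ cong (_+ κ * n) (∑-id-odd κ) ⟩
  κ * n + κ * n                   ≡⟨ eq κ ⟩
  2 * κ * n                       ∎
  where
  open ≤-Reasoning
  n = 1 + 2 * κ
  eq : ∀ κ → κ * (1 + 2 * κ) + κ * (1 + 2 * κ) ≡ 2 * κ * (1 + 2 * κ)
  eq = solve-∀

tail : Graph → Graph
tail G i j = G (suc i) (suc j)

edges-tail : ∀ n G → edges (suc n) G ≡ ∑ n (λ j → ⟦ G 0 (suc j) ⟧) + edges n (tail G)
edges-tail n G = trans (∑-split 1 n _) (trans (∑-cong n (λ j _ → ∑-split 1 j _)) (∑-+ n _ _))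

tail-free : ∀ {k n G} → ¬ Crossings G k (suc n) → ¬ Crossings (tail G) k n
tail-free {k} {n} {G} free (q , c) = free (suc q , shift c)
  where
  shift : ∀ {m i j} → Chain (EdgeAbove (tail G) q) m i j → Chain (EdgeAbove G (suc q)) m (suc i) (suc j)
  shift [] = []
  shift (c ▻ ((e , q≤) , x<i , y<j)) = shift c ▻ ((e , s≤s q≤) , s<s x<i , s<s y<j)

capoyleas-pach : ∀ κ n → Acc _<_ n → ∀ G → 1 + 2 * κ ≤ n → ¬ Crossings G (suc κ) n → Bound κ n (edges n G)
capoyleas-pach κ n (acc rec) G 1+2κ≤n free with m≤n⇒∃[o]m+o≡n 1+2κ≤n
... | zero , refl rewrite +-identityʳ (2 * κ) = edges-complete κ G
-- The vertices `1 + κ + t` with `t ≤ w` are those at cyclic distance more than κ from 0. If none of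
-- them is a neighbour, the κ vertices on either side bound the degree of 0 by `2 * κ`.
... | suc w , refl with ∑ (suc w) (λ t → ⟦ G 0 (1 + κ + t) ⟧) in mid
... | zero = begin
    edges (1 + 2 * κ + suc w) G + K    ≡⟨ cong (λ t → edges t G + K) (+-suc (1 + 2 * κ) w) ⟩
    edges (suc n′) G + K               ≡⟨ cong (_+ K) (edges-tail n′ G) ⟩
    deg + edges n′ (tail G) + K        ≡⟨ +-assoc deg _ K ⟩
    deg + (edges n′ (tail G) + K)      ≤⟨ +-mono-≤ deg≤ IH ⟩
    2 * κ + 2 * κ * n′                 ≡⟨ eq κ w ⟩
    2 * κ * (1 + 2 * κ + suc w)        ∎
  where
  open ≤-Reasoning
  n′ = 1 + 2 * κ + w
  K = κ * (1 + 2 * κ)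
  deg = ∑ n′ (λ j → ⟦ G 0 (suc j) ⟧)
  IH : edges n′ (tail G) + K ≤ 2 * κ * n′
  IH = capoyleas-pach κ n′ (rec (≤-reflexive (sym (+-suc (1 + 2 * κ) w)))) (tail G) (m≤m+n _ w)
    (tail-free (subst (λ t → ¬ Crossings G (suc κ) t) (+-suc (1 + 2 * κ) w) free))
  eq : ∀ κ w → 2 * κ + 2 * κ * (1 + 2 * κ + w) ≡ 2 * κ * (1 + 2 * κ + (1 + w))
  eq = solve-∀
  cut : ∀ κ w → 1 + 2 * κ + w ≡ κ + (suc w + κ)
  cut = solve-∀
  deg≤ : deg ≤ 2 * κ
  deg≤ = begin
    deg                                     ≡⟨ cong (λ t → ∑ t (λ j → ⟦ G 0 (suc j) ⟧)) (cut κ w) ⟩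
    ∑ (κ + (suc w + κ)) (λ j → ⟦ G 0 (suc j) ⟧)
      ≡⟨ trans (∑-split κ (suc w + κ) _) (cong (∑ κ (λ j → ⟦ G 0 (suc j) ⟧) +_) (∑-split (suc w) κ _)) ⟩
    ∑ κ (λ j → ⟦ G 0 (suc j) ⟧) + (∑ (suc w) (λ t → ⟦ G 0 (1 + κ + t) ⟧) + ∑ κ (λ t → ⟦ G 0 (suc (κ + (suc w + t))) ⟧))
      ≤⟨ +-mono-≤ (∑-⟦⟧≤ κ _) (+-mono-≤ (≤-reflexive mid) (∑-⟦⟧≤ κ _)) ⟩
    κ + (0 + κ)                             ≡⟨ cong (κ +_) (sym (+-identityʳ κ)) ⟩
    2 * κ                                   ∎
... | suc _ with t , t<1+w , pos ← ∑-pos (suc w) _ (subst (0 <_) (sym mid) z<s)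
    with o , refl ← m≤n⇒∃[o]m+o≡n (≤-pred t<1+w) = cut κ refl
  where
  arrange : ∀ κ t o → 1 + 2 * κ + suc (t + o) ≡ 2 + (κ + t) + (κ + o)
  arrange = solve-∀
  cut : ∀ κ′ → κ ≡ κ′ → Bound κ (1 + 2 * κ + suc (t + o)) (edges (1 + 2 * κ + suc (t + o)) G)
  -- For κ = 0 a single edge already counts as κ + 1 crossing edges.
  cut zero refl = contradiction (1 + t , [] ▻ ((⟦⟧-pos pos , ≤-refl) , z<s , s<s (s≤s (m≤m+n t o)))) free
  -- The two parts share 0, `y` and gain `s` new vertices each, so together they have `2 * κ` more
  -- vertices than `G`. The term `4 * κ * κ` compensates for these.
  cut (suc s) refl = subst (λ n → Bound κ n (edges n G)) (sym arr) (+-cancelʳ-≤ (4 * κ * κ) _ _ (begin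
      edges (2 + a + b) G + κ * (1 + 2 * κ) + 4 * κ * κ
        ≡⟨ eq₁ (edges (2 + a + b) G) s ⟩
      edges (2 + a + b) G + κ * (1 + 2 * s) + (K + K)
        ≤⟨ +-monoˡ-≤ (K + K) S.edges-split ⟩
      edges (2 + a + s) S.left + edges (2 + s + b) S.right + (K + K)
        ≡⟨ eq₂ (edges (2 + a + s) S.left) (edges (2 + s + b) S.right) K ⟩
      (edges (2 + a + s) S.left + K) + (edges (2 + s + b) S.right + K)
        ≤⟨ +-mono-≤
            (capoyleas-pach κ (2 + a + s) (rec (subst (2 + a + s <_) (sym arr) (+-monoʳ-< (2 + a) s<b))) S.left
              (≤-trans (≤-reflexive (size s)) (+-monoˡ-≤ s (+-monoʳ-≤ 2 s<a))) S.left-free)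
            (capoyleas-pach κ (2 + s + b) (rec (subst (2 + s + b <_) (sym arr) (+-monoˡ-< b (+-monoʳ-< 2 s<a)))) S.right
              (≤-trans (≤-reflexive (size′ s)) (+-monoʳ-≤ (2 + s) s<b)) S.right-free) ⟩
      2 * κ * (2 + a + s) + 2 * κ * (2 + s + b)
        ≡⟨ eq₃ s a b ⟩
      2 * κ * (2 + a + b) + 4 * κ * κ ∎))
    where
    open ≤-Reasoning
    a = κ + t
    b = κ + o
    K = κ * (1 + 2 * κ)
    arr : 1 + 2 * κ + suc (t + o) ≡ 2 + a + b
    arr = arrange κ t o
    s<a : s < a
    s<a = m≤m+n κ t
    s<b : s < b
    s<b = m≤m+n κ o
    module S = Split G a b s s<a s<b (⟦⟧-pos pos) (subst (λ n → ¬ Crossings G (suc κ) n) arr free)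
    size : ∀ s → 1 + 2 * (1 + s) ≡ 2 + (1 + s) + s
    size = solve-∀
    size′ : ∀ s → 1 + 2 * (1 + s) ≡ 2 + s + (1 + s)
    size′ = solve-∀
    eq₁ : ∀ e s → e + (1 + s) * (1 + 2 * (1 + s)) + 4 * (1 + s) * (1 + s) ≡
      e + (1 + s) * (1 + 2 * s) + ((1 + s) * (1 + 2 * (1 + s)) + (1 + s) * (1 + 2 * (1 + s)))
    eq₁ = solve-∀
    eq₂ : ∀ l r k → l + r + (k + k) ≡ (l + k) + (r + k)
    eq₂ = solve-∀
    eq₃ : ∀ s a b → 2 * (1 + s) * (2 + a + s) + 2 * (1 + s) * (2 + s + b) ≡ 2 * (1 + s) * (2 + a + b) + 4 * (1 + s) * (1 + s)
    eq₃ = solve-∀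

-- Edges of one fixed length.

even : ℕ → Bool
even zero    = true
even (suc n) = not (even n)

Alternating : (ℕ → Bool) → Set
Alternating c = ∀ n → c n ≡ true → ¬ (c (suc n) ≡ true)

even-alternating : Alternating even
even-alternating n p q with even n
even-alternating n p () | true
even-alternating n () q | false

odd-alternating : Alternating (not ∘ even)
odd-alternating n p q with even n
odd-alternating n () q | true
odd-alternating n p () | false

DiagonalEdge : Graph → ℕ → (ℕ → Bool) → ℕ → ℕ → Set
DiagonalEdge G d c x y = G x y ≡ true × x + suc d ≡ y × c (y / suc d) ≡ true

diagonal : Graph → ℕ → ℕ → Bool
diagonal G d y = (d <ᵇ y) ∧ G (y ∸ suc d) y

-- Edges of equal length increase in both ends at once, so they form a chain when listed by right
-- end.
diagonal-chain : ∀ G d c n m {i} → n ≤ i + suc d →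
  m ≤ ∑ n (λ y → ⟦ diagonal G d y ∧ c (y / suc d) ⟧) → Chain (DiagonalEdge G d c) m i n
diagonal-chain G d c n       zero    n≤ m≤ = []
diagonal-chain G d c (suc n) (suc m) {i} n≤ m≤ with diagonal G d n ∧ c (n / suc d) in eq
... | false = chain-weaken ≤-refl (n≤1+n n)
  (diagonal-chain G d c n (suc m) (≤-trans (n≤1+n n) n≤) (≤-trans m≤ (≤-reflexive (+-identityʳ _))))
... | true =
  let dg , cy = ∧-true {diagonal G d n} eq
      d<n , g = ∧-true {d <ᵇ n} dg
      x+d≡n = m∸n+n≡m (<ᵇ≡⇒< {d} {n} d<n)
  in diagonal-chain G d c n m (≤-reflexive (sym x+d≡n)) (≤-pred (≤-trans m≤ (≤-reflexive (+-comm _ 1)))) ▻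
     ((g , x+d≡n , cy) , +-cancelʳ-< (suc d) _ i (subst (_< i + suc d) (sym x+d≡n) n≤) , ≤-refl)

diagonal-bound : ∀ κ n G d →
  (∀ c → Alternating c → ¬ Chain (DiagonalEdge G d c) (suc κ) n n) →
  ∑ n (λ y → ⟦ diagonal G d y ⟧) ≤ κ + κ
diagonal-bound κ n G d free = begin
  ∑ n (λ y → ⟦ diagonal G d y ⟧)      ≡⟨ ∑-cong n (λ y _ → halves (diagonal G d y) (even (y / suc d))) ⟩
  ∑ n (λ y → ⟦ diagonal G d y ∧ even (y / suc d) ⟧ + ⟦ diagonal G d y ∧ not (even (y / suc d)) ⟧)
                                      ≡⟨ ∑-+ n _ _ ⟩
  part even + part (not ∘ even)   ≤⟨ +-mono-≤ (part≤ even even-alternating) (part≤ (not ∘ even) odd-alternating) ⟩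
  κ + κ                               ∎
  where
  open ≤-Reasoning
  part : (ℕ → Bool) → ℕ
  part c = ∑ n (λ y → ⟦ diagonal G d y ∧ c (y / suc d) ⟧)
  part≤ : ∀ c → Alternating c → part c ≤ κ
  part≤ c alt = ≮⇒≥ λ κ< → free c alt (diagonal-chain G d c n (suc κ) (m≤m+n n _) κ<)
  halves : ∀ x p → ⟦ x ⟧ ≡ ⟦ x ∧ p ⟧ + ⟦ x ∧ not p ⟧
  halves false p     = refl
  halves true  true  = refl
  halves true  false = refl

-- Short and long edges counted together.

column-split : ∀ κ j (h : ℕ → Bool) →
  ∑ j (λ i → ⟦ h i ⟧) ≤ ∑ (j ∸ κ) (λ i → ⟦ h i ⟧) + ∑ κ (λ d → ⟦ (d <ᵇ j) ∧ h (j ∸ suc d) ⟧)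
column-split zero    j h = m≤m+n _ 0
column-split (suc κ) j h = ≤-trans (column-split κ j h) (begin
    ∑ (j ∸ κ) (λ i → ⟦ h i ⟧) + S                    ≤⟨ +-monoˡ-≤ S step ⟩
    ∑ (j ∸ suc κ) (λ i → ⟦ h i ⟧) + l + S            ≡⟨ eq _ l S ⟩
    ∑ (j ∸ suc κ) (λ i → ⟦ h i ⟧) + (S + l)          ∎)
  where
  open ≤-Reasoning
  S = ∑ κ (λ d → ⟦ (d <ᵇ j) ∧ h (j ∸ suc d) ⟧)
  l = ⟦ (κ <ᵇ j) ∧ h (j ∸ suc κ) ⟧
  eq : ∀ x l s → x + l + s ≡ x + (s + l)
  eq = solve-∀
  step : ∑ (j ∸ κ) (λ i → ⟦ h i ⟧) ≤ ∑ (j ∸ suc κ) (λ i → ⟦ h i ⟧) + l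
  step with κ <? j
  ... | yes κ<j rewrite <⇒<ᵇ≡ κ<j | +-∸-assoc 1 κ<j = ≤-refl
  ... | no κ≮j rewrite m≤n⇒m∸n≡0 (≮⇒≥ κ≮j) = z≤n

fill : ℕ → Graph → Graph
fill κ G i j = (j <ᵇ suc (i + κ)) ∨ G i j

-- In κ + 1 crossing edges, let `m` lie below a given one. The left ends of those above it lie
-- between its left end and `q`, the right ends of those below it between `q` and its right end. So
-- the edge is longer than κ and was not filled in.
fill-free : ∀ κ n G → ¬ Crossings G (suc κ) n → ¬ Crossings (fill κ G) (suc κ) n
fill-free κ n G free (q , c) = free (q , long c ≤-refl)
  where
  long : ∀ {m i j} → Chain (EdgeAbove (fill κ G) q) m i j → i + suc κ ≤ q + m → Chain (EdgeAbove G q) m i j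
  long [] _ = []
  long {suc m} (_▻_ {x = x} {z} c ((e , q≤z) , x<i , z<j)) inv = long c inv′ ▻ ((e′ , q≤z) , x<i , z<j)
    where
    inv′ : x + suc κ ≤ q + m
    inv′ = ≤-pred (≤-trans (+-monoˡ-≤ (suc κ) x<i) (≤-trans inv (≤-reflexive (+-suc q m))))
    e′ : G x z ≡ true
    e′ with ∨-true {z <ᵇ suc (x + κ)} e
    ... | inj₂ g = g
    ... | inj₁ p = contradiction (<ᵇ≡⇒< {z} p)
      (≤⇒≯ (≤-trans (≤-reflexive (sym (+-suc x κ))) (≤-trans inv′ (chain-cols q≤z proj₂ c))))

fill-column : ∀ κ j G → ∑ (j ∸ κ) (λ i → ⟦ G i j ⟧) + (κ ⊓ j) ≤ ∑ j (λ i → ⟦ fill κ G i j ⟧)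
fill-column κ j G = begin
  ∑ (j ∸ κ) (λ i → ⟦ G i j ⟧) + (κ ⊓ j)
    ≤⟨ +-mono-≤ (∑-mono (j ∸ κ) (λ i _ → ⟦⟧-mono (∨-introʳ {j <ᵇ suc (i + κ)})))
         (≤-reflexive (sym (trans (∑-cong (κ ⊓ j) (λ i _ → cong ⟦_⟧ (short i))) (trans (∑-const (κ ⊓ j) 1) (*-identityʳ _))))) ⟩
  ∑ (j ∸ κ) (λ i → ⟦ fill κ G i j ⟧) + ∑ (κ ⊓ j) (λ i → ⟦ fill κ G (j ∸ κ + i) j ⟧)
    ≡⟨ ∑-split (j ∸ κ) (κ ⊓ j) _ ⟨
  ∑ (j ∸ κ + (κ ⊓ j)) (λ i → ⟦ fill κ G i j ⟧)
    ≡⟨ cong (λ t → ∑ t (λ i → ⟦ fill κ G i j ⟧)) (trans (+-comm (j ∸ κ) _) (m⊓n+n∸m≡n κ j)) ⟩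
  ∑ j (λ i → ⟦ fill κ G i j ⟧) ∎
  where
  open ≤-Reasoning
  short : ∀ i → fill κ G (j ∸ κ + i) j ≡ true
  short i = ∨-introˡ (<⇒<ᵇ≡ (s≤s (≤-trans (m≤n+m∸n j κ) (≤-trans (≤-reflexive (+-comm κ (j ∸ κ))) (+-monoˡ-≤ κ (m≤m+n (j ∸ κ) i))))))

∑-⊓ : ∀ κ t → 2 * ∑ (κ + t) (κ ⊓_) + κ * (1 + κ) ≡ 2 * κ * (κ + t)
∑-⊓ κ t = begin
  2 * ∑ (κ + t) (κ ⊓_) + κ * (1 + κ)
    ≡⟨ cong (λ s → 2 * s + κ * (1 + κ)) (trans (∑-split κ t (κ ⊓_)) (cong₂ _+_
         (∑-cong κ (λ j j<κ → m≥n⇒m⊓n≡n (<⇒≤ j<κ)))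
         (trans (∑-cong t (λ i _ → m≤n⇒m⊓n≡m (m≤m+n κ i))) (∑-const t κ)))) ⟩
  2 * (T₀ + t * κ) + κ * (1 + κ)    ≡⟨ eq₁ T₀ t κ ⟩
  (2 * T₀ + κ) + (2 * t * κ + κ * κ) ≡⟨ cong (_+ (2 * t * κ + κ * κ)) (∑-id κ) ⟩
  κ * κ + (2 * t * κ + κ * κ)       ≡⟨ eq₂ t κ ⟩
  2 * κ * (κ + t) ∎
  where
  open ≡-Reasoning
  T₀ = ∑ κ (λ j → j)
  eq₁ : ∀ x t κ → 2 * (x + t * κ) + κ * (1 + κ) ≡ (2 * x + κ) + (2 * t * κ + κ * κ)
  eq₁ = solve-∀
  eq₂ : ∀ t κ → κ * κ + (2 * t * κ + κ * κ) ≡ 2 * κ * (κ + t)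
  eq₂ = solve-∀

-- The inequality is doubled to avoid division: `κ * κ` minus κ is twice the binomial coefficient.
edges-bound : ∀ κ n G → 1 + 2 * κ ≤ n → ¬ Crossings G (suc κ) n →
  (∀ d c → Alternating c → ¬ Chain (DiagonalEdge G d c) (suc κ) n n) →
  2 * edges n G + κ ≤ 2 * (κ * n) + κ * κ
edges-bound κ n G 1+2κ≤n cross diag = +-cancelʳ-≤ (2 * κ * n) _ _ (begin
    2 * edges n G + κ + 2 * κ * n
      ≤⟨ +-monoˡ-≤ (2 * κ * n) (+-monoˡ-≤ κ (*-monoʳ-≤ 2 split)) ⟩
    2 * (long + κ * (κ + κ)) + κ + 2 * κ * n
      ≡⟨ cong (2 * (long + κ * (κ + κ)) + κ +_) (sym total) ⟩
    2 * (long + κ * (κ + κ)) + κ + (2 * M + κ * (1 + κ))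
      ≡⟨ eq₁ long κ M ⟩
    2 * (long + M + κ * (1 + 2 * κ)) + κ * κ
      ≤⟨ +-monoˡ-≤ (κ * κ) (*-monoʳ-≤ 2 (≤-trans (+-monoˡ-≤ _ filled)
           (capoyleas-pach κ n (<-wellFounded n) (fill κ G) 1+2κ≤n (fill-free κ n G cross)))) ⟩
    2 * (2 * κ * n) + κ * κ
      ≡⟨ eq₂ κ n ⟩
    2 * (κ * n) + κ * κ + 2 * κ * n ∎)
  where
  open ≤-Reasoning
  M = ∑ n (κ ⊓_)
  long = ∑ n (λ j → ∑ (j ∸ κ) (λ i → ⟦ G i j ⟧))
  total : 2 * M + κ * (1 + κ) ≡ 2 * κ * n
  total with t , refl ← m≤n⇒∃[o]m+o≡n (≤-trans (≤-trans (m≤m+n κ (κ + 0)) (n≤1+n (2 * κ))) 1+2κ≤n) = ∑-⊓ κ t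
  split : edges n G ≤ long + κ * (κ + κ)
  split = begin
    edges n G
      ≤⟨ ∑-mono n (λ j _ → column-split κ j (λ i → G i j)) ⟩
    ∑ n (λ j → ∑ (j ∸ κ) (λ i → ⟦ G i j ⟧) + ∑ κ (λ d → ⟦ diagonal G d j ⟧))
      ≡⟨ trans (∑-+ n _ _) (cong (long +_) (∑-swap n κ _)) ⟩
    long + ∑ κ (λ d → ∑ n (λ j → ⟦ diagonal G d j ⟧))
      ≤⟨ +-monoʳ-≤ long (∑-mono κ (λ d _ → diagonal-bound κ n G d (diag d))) ⟩
    long + ∑ κ (λ _ → κ + κ)
      ≡⟨ cong (long +_) (∑-const κ (κ + κ)) ⟩
    long + κ * (κ + κ) ∎
  filled : long + M ≤ edges n (fill κ G)
  filled = ≤-trans (≤-reflexive (sym (∑-+ n _ _))) (∑-mono n (λ j _ → fill-column κ j G))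
  eq₁ : ∀ l κ m → 2 * (l + κ * (κ + κ)) + κ + (2 * m + κ * (1 + κ)) ≡ 2 * (l + m + κ * (1 + 2 * κ)) + κ * κ
  eq₁ = solve-∀
  eq₂ : ∀ κ n → 2 * (2 * κ * n) + κ * κ ≡ 2 * (κ * n) + κ * κ + 2 * κ * n
  eq₂ = solve-∀

-- Increasing maps and sorting.

StrictlyMonotone : ∀ {m n} → (Fin m → Fin n) → Set
StrictlyMonotone f = ∀ a b → a <ᶠ b → f a <ᶠ f b

module _ {m n} {f : Fin m → Fin n} (mono : StrictlyMonotone f) where

  mono-reflects-< : ∀ {a b} → f a <ᶠ f b → a <ᶠ b
  mono-reflects-< {a} {b} fa<fb with Finₚ.<-cmp a b
  ... | tri< a<b _ _ = a<b
  ... | tri≈ _ refl _ = contradiction fa<fb (Finₚ.<-irrefl refl)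
  ... | tri> _ _ b<a = contradiction (Finₚ.<-trans fa<fb (mono b a b<a)) (Finₚ.<-irrefl refl)

  mono-injective : Injective _≡_ _≡_ f
  mono-injective {a} {b} eq with Finₚ.<-cmp a b
  ... | tri< a<b _ _ = contradiction (mono a b a<b) (Finₚ.<-irrefl eq)
  ... | tri≈ _ a≡b _ = a≡b
  ... | tri> _ _ b<a = contradiction (mono b a b<a) (Finₚ.<-irrefl (sym eq))

enumerate : ∀ n {S : Fin n → Set} → (∀ v → Dec (S v)) →
  Σ ℕ λ m → Σ (Fin m → Fin n) λ f → StrictlyMonotone f × (∀ i → S (f i)) × (∀ v → S v → ∃[ i ] f i ≡ v)
enumerate zero S? = 0 , (λ ()) , (λ ()) , (λ ()) , λ ()
enumerate (suc n) {S} S? with m , f , mono , inS , onto ← enumerate n (S? ∘ suc) | S? zero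
... | no ¬s₀ = m , suc ∘ f , (λ a b a<b → s≤s (mono a b a<b)) , inS ,
  λ { zero s → contradiction s ¬s₀ ; (suc v) s → map₂ (cong suc) (onto v s) }
... | yes s₀ = suc m , f′ , mono′ , inS′ ,
  λ { zero s → zero , refl ; (suc v) s → let i , eq = onto v s in suc i , cong suc eq }
  where
  f′ : Fin (suc m) → Fin (suc n)
  f′ zero    = zero
  f′ (suc i) = suc (f i)
  mono′ : StrictlyMonotone f′
  mono′ zero    (suc b) _ = z<s
  mono′ (suc a) (suc b) a<b = s≤s (mono a b (≤-pred a<b))
  inS′ : ∀ i → S (f′ i)
  inS′ zero    = s₀
  inS′ (suc i) = inS i

-- The image of `h` is enumerated in increasing order; injections in both directions show that it
-- has exactly `m` elements. `σ` records positions in that order.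
sortInjection : ∀ {m n} (h : Fin m → Fin n) → Injective _≡_ _≡_ h →
  Σ (Fin m → Fin n) λ f → StrictlyMonotone f × Σ (Fin m → Fin m) λ σ → ∀ i → f (σ i) ≡ h i
sortInjection {m} {n} h inj
  with m′ , f , mono , inS , onto ← enumerate n {λ v → ∃[ i ] h i ≡ v} (λ v → Finₚ.any? (λ i → h i ≟ᶠ v))
  with refl ← ≤-antisym
    (Finₚ.injective⇒≤ {f = λ i → proj₁ (onto (h i) (i , refl))} (λ {i} {j} eq →
      inj (trans (sym (proj₂ (onto (h i) (i , refl)))) (trans (cong f eq) (proj₂ (onto (h j) (j , refl)))))))
    (Finₚ.injective⇒≤ {f = λ i → proj₁ (inS i)} (λ {i} {j} eq →
      mono-injective mono (trans (sym (proj₂ (inS i))) (trans (cong h eq) (proj₂ (inS j)))))) =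
  f , mono , (λ i → proj₁ (onto (h i) (i , refl))) , λ i → proj₂ (onto (h i) (i , refl))

-- Decidability of freeness is what makes the maximum in IsEx constructively available.
Searchable : Set → Set₁
Searchable A = ∀ {P : A → Set} → (∀ a → Dec (P a)) → Dec (∃[ a ] P a)

search-Fin : ∀ {n} → Searchable (Fin n)
search-Fin = Finₚ.any?

search-Bool : Searchable Bool
search-Bool P? = map′ [ (λ p → true , p) , (λ p → false , p) ]′
  (λ { (true , p) → inj₁ p ; (false , p) → inj₂ p }) (P? true ⊎-dec P? false)

search-× : ∀ {A B} → Searchable A → Searchable B → Searchable (A × B)
search-× sA sB P? = map′ (λ (a , b , p) → (a , b) , p) (λ ((a , b) , p) → a , b , p)
  (sA (λ a → sB (λ b → P? (a , b))))

search-Vec : ∀ {A} → Searchable A → ∀ n → Searchable (Vec A n)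
search-Vec sA zero    P? = map′ ([] ,_) (λ { ([] , p) → p }) (P? [])
search-Vec sA (suc n) P? = map′ (λ (a , v , p) → a ∷ v , p) (λ { (a ∷ v , p) → a , v , p })
  (sA (λ a → search-Vec sA n (λ v → P? (a ∷ v))))

-- Deciding whether a graph contains a member of a matching family.

Disjoint : ∀ {n} → Fin n → Fin n → Fin n → Fin n → Set
Disjoint x y u v = (x ≢ u) × (x ≢ v) × (y ≢ u) × (y ≢ v)

endpoints : ∀ {k n} → (Fin k → Fin n) → (Fin k → Fin n) → Fin (k + k) → Fin n
endpoints {k} l u = [ l , u ]′ ∘ splitAt k

endpoints-injective : ∀ {k n} {l u : Fin k → Fin n} → (∀ i → l i <ᶠ u i) →
  (∀ i j → i ≢ j → Disjoint (l i) (u i) (l j) (u j)) → Injective _≡_ _≡_ (endpoints l u)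
endpoints-injective {k} {l = l} {u} l<u dis {a} {b} eq =
  trans (sym (Finₚ.join-splitAt k k a)) (trans (cong (join k k) (sides (splitAt k a) (splitAt k b) eq)) (Finₚ.join-splitAt k k b))
  where
  sides : ∀ a b → [ l , u ]′ a ≡ [ l , u ]′ b → a ≡ b
  sides (inj₁ i) (inj₁ j) eq with i ≟ᶠ j
  ... | yes refl = refl
  ... | no i≢j   = contradiction eq (proj₁ (dis i j i≢j))
  sides (inj₁ i) (inj₂ j) eq with i ≟ᶠ j
  ... | yes refl = contradiction (l<u i) (Finₚ.<-irrefl eq)
  ... | no i≢j   = contradiction eq (proj₁ (proj₂ (dis i j i≢j)))
  sides (inj₂ i) (inj₁ j) eq with i ≟ᶠ j
  ... | yes refl = contradiction (l<u i) (Finₚ.<-irrefl (sym eq))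
  ... | no i≢j   = contradiction eq (proj₁ (proj₂ (proj₂ (dis i j i≢j))))
  sides (inj₂ i) (inj₂ j) eq with i ≟ᶠ j
  ... | yes refl = refl
  ... | no i≢j   = contradiction eq (proj₂ (proj₂ (proj₂ (dis i j i≢j))))

-- Handles both families at once: `R` is a condition on two edges with labels `p` and `q`, carried
-- along increasing maps in both directions.
module PairFamily {k : ℕ}
  (R : ∀ {m} → Fin m → Fin m → Fin m → Fin m → Fin k → Fin k → Set)
  (R? : ∀ {m} (x y u v : Fin m) p q → Dec (R x y u v p q))
  (R-map : ∀ {m n} {f : Fin m → Fin n} → StrictlyMonotone f → ∀ {x y u v p q} →
    R x y u v p q → R (f x) (f y) (f u) (f v) p q)
  (R-comap : ∀ {m n} {f : Fin m → Fin n} → StrictlyMonotone f → ∀ {x y u v p q} →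
    R (f x) (f y) (f u) (f v) p q → R x y u v p q)
  where

  Fam : Family k
  Fam M = Σ (Fin k → Fin k) λ part → ∀ i j → i ≢ j → R (lo M i) (hi M i) (lo M j) (hi M j) (part i) (part j)

  Labelled : ℕ → Set
  Labelled n = Fin n × Fin n × Fin k

  Compatible : ∀ {n} → OGraph n → Fin k → Fin k → Labelled n → Labelled n → Set
  Compatible G i j (x , y , p) (u , v , q) =
    Edge G x y × (i ≢ j → Disjoint x y u v × R x y u v p q)

  compatible? : ∀ {n} (G : OGraph n) i j a b → Dec (Compatible G i j a b)
  compatible? G i j (x , y , p) (u , v , q) =
    (x <?ᶠ y ×-dec (G x y Bool.≟ true)) ×-dec
    (¬? (i ≟ᶠ j) →-dec ((¬? (x ≟ᶠ u) ×-dec ¬? (x ≟ᶠ v) ×-dec ¬? (y ≟ᶠ u) ×-dec ¬? (y ≟ᶠ v)) ×-dec R? x y u v p q))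

  -- Records only the image of a copy: `k` labelled edges of `G`. This is finite data and can be
  -- searched.
  Placement : ∀ {n} → OGraph n → (Fin k → Labelled n) → Set
  Placement G e = ∀ i j → Compatible G i j (e i) (e j)

  placement? : ∀ {n} (G : OGraph n) → Dec (∃[ e ] Placement G e)
  placement? {n} G = map′ (λ (v , c) → lookup v , c)
    (λ (e , c) → tabulate e , λ i j → subst₂ (Compatible G i j) (sym (lookup∘tabulate e i)) (sym (lookup∘tabulate e j)) (c i j))
    (search-Vec (search-× search-Fin (search-× search-Fin search-Fin)) k
      (λ v → Finₚ.all? (λ i → Finₚ.all? (λ j → compatible? G i j (lookup v i) (lookup v j)))))

  copy⇒placement : ∀ {n} {G : OGraph n} M → Fam M → ContainsCopy G M → ∃[ e ] Placement G e
  copy⇒placement {G = G} M (part , fam) (f , mono , edge) =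
    (λ i → f (lo M i) , f (hi M i) , part i) , λ i j →
      edge _ _ (i , refl , refl) , λ i≢j →
        let d₁ , d₂ , d₃ , d₄ = disjoint M i j i≢j ; inj = mono-injective mono
        in (d₁ ∘ inj , d₂ ∘ inj , d₃ ∘ inj , d₄ ∘ inj) , R-map mono (fam i j i≢j)

  -- Sorting the `k + k` distinct endpoints gives the embedding, and the matching is the pullback of
  -- the edges along it.
  placement⇒copy : ∀ {n} {G : OGraph n} e → Placement G e → Σ (Matching k) λ M → Fam M × ContainsCopy G M
  placement⇒copy {n} {G} e place = M , ((λ i → proj₂ (proj₂ (e i))) , fam) , f , mono , edge
    where
    l₀ u₀ : Fin k → Fin n
    l₀ i = proj₁ (e i)
    u₀ i = proj₁ (proj₂ (e i))
    lo<hi′ : ∀ i → l₀ i <ᶠ u₀ i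
    lo<hi′ i = proj₁ (proj₁ (place i i))
    dis : ∀ i j → i ≢ j → Disjoint (l₀ i) (u₀ i) (l₀ j) (u₀ j)
    dis i j i≢j = proj₁ (proj₂ (place i j) i≢j)
    sorted = sortInjection (endpoints l₀ u₀) (endpoints-injective lo<hi′ dis)
    f = proj₁ sorted
    mono : StrictlyMonotone f
    mono = proj₁ (proj₂ sorted)
    σ = proj₁ (proj₂ (proj₂ sorted))
    fσ : ∀ i → f (σ i) ≡ endpoints l₀ u₀ i
    fσ = proj₂ (proj₂ (proj₂ sorted))
    l u : Fin k → Fin (k + k)
    l i = σ (i ↑ˡ k)
    u i = σ (k ↑ʳ i)
    fl : ∀ i → f (l i) ≡ l₀ i
    fl i = trans (fσ (i ↑ˡ k)) (cong [ l₀ , u₀ ]′ (Finₚ.splitAt-↑ˡ k i k))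
    fu : ∀ i → f (u i) ≡ u₀ i
    fu i = trans (fσ (k ↑ʳ i)) (cong [ l₀ , u₀ ]′ (Finₚ.splitAt-↑ʳ k k i))
    distinct : ∀ {a b v w} → f a ≡ v → f b ≡ w → v ≢ w → a ≢ b
    distinct fa fb v≢w a≡b = v≢w (trans (sym fa) (trans (cong f a≡b) fb))
    M : Matching k
    M = record
      { lo = l ; hi = u
      ; lo<hi = λ i → mono-reflects-< mono (subst₂ _<ᶠ_ (sym (fl i)) (sym (fu i)) (lo<hi′ i))
      ; disjoint = λ i j i≢j → let d₁ , d₂ , d₃ , d₄ = dis i j i≢j in
          distinct (fl i) (fl j) d₁ , distinct (fl i) (fu j) d₂ ,
          distinct (fu i) (fl j) d₃ , distinct (fu i) (fu j) d₄ }
    fam : ∀ i j → i ≢ j → R (l i) (u i) (l j) (u j) _ _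
    fam i j i≢j = R-comap mono (subst₂ (λ x y → R x y (f (l j)) (f (u j)) _ _) (sym (fl i)) (sym (fu i))
      (subst₂ (λ x y → R _ _ x y _ _) (sym (fl j)) (sym (fu j)) (proj₂ (proj₂ (place i j) i≢j))))
    edge : ∀ a b → MEdge M a b → Edge G (f a) (f b)
    edge _ _ (i , refl , refl) = subst₂ (Edge G) (sym (fl i)) (sym (fu i)) (proj₁ (place i i))

  free? : ∀ {n} (G : OGraph n) → Dec (Free G Fam)
  free? G with placement? G
  ... | yes (e , p) = no λ free → let M , fam , copy = placement⇒copy {G = G} e p in free M fam copy
  ... | no ¬p       = yes λ M fam copy → ¬p (copy⇒placement {G = G} M fam copy)

-- The two families as instances.

nested? : ∀ {m} (x y u v : Fin m) → Dec (Nested x y u v)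
nested? x y u v = (x <?ᶠ u ×-dec v <?ᶠ y) ⊎-dec (u <?ᶠ x ×-dec y <?ᶠ v)

separated? : ∀ {m} (x y u v : Fin m) → Dec (Separated x y u v)
separated? x y u v = y <?ᶠ u ⊎-dec v <?ᶠ x

module _ {m n} {f : Fin m → Fin n} (mono : StrictlyMonotone f) {x y u v : Fin m} where

  private
    reflect = mono-reflects-< mono

  nested-map : Nested x y u v → Nested (f x) (f y) (f u) (f v)
  nested-map = Sum.map (λ (p , q) → mono _ _ p , mono _ _ q) (λ (p , q) → mono _ _ p , mono _ _ q)

  nested-comap : Nested (f x) (f y) (f u) (f v) → Nested x y u v
  nested-comap = Sum.map (λ (p , q) → reflect p , reflect q) (λ (p , q) → reflect p , reflect q)

  separated-map : Separated x y u v → Separated (f x) (f y) (f u) (f v)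
  separated-map = Sum.map (mono _ _) (mono _ _)

  separated-comap : Separated (f x) (f y) (f u) (f v) → Separated x y u v
  separated-comap = Sum.map reflect reflect

module NonNestedFamily (k : ℕ) = PairFamily {k}
  (λ x y u v _ _ → ¬ Nested x y u v)
  (λ x y u v _ _ → ¬? (nested? x y u v))
  (λ mono → _∘ nested-comap mono)
  (λ mono → _∘ nested-map mono)

StrongPair : ∀ {n k} → Fin n → Fin n → Fin n → Fin n → Fin k → Fin k → Set
StrongPair x y u v p q = (p ≡ q → Crossing x y u v) × (p ≢ q → Separated x y u v)

strongPair? : ∀ {n k} (x y u v : Fin n) (p q : Fin k) → Dec (StrongPair x y u v p q)
strongPair? x y u v p q =
  ((p ≟ᶠ q) →-dec (¬? (separated? x y u v) ×-dec ¬? (nested? x y u v))) ×-dec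
  (¬? (p ≟ᶠ q) →-dec separated? x y u v)

module _ {m n k} {f : Fin m → Fin n} (mono : StrictlyMonotone f) {x y u v : Fin m} {p q : Fin k} where

  strongPair-map : StrongPair x y u v p q → StrongPair (f x) (f y) (f u) (f v) p q
  strongPair-map (c , s) =
    (λ e → proj₁ (c e) ∘ separated-comap mono , proj₂ (c e) ∘ nested-comap mono) , separated-map mono ∘ s

  strongPair-comap : StrongPair (f x) (f y) (f u) (f v) p q → StrongPair x y u v p q
  strongPair-comap (c , s) =
    (λ e → proj₁ (c e) ∘ separated-map mono , proj₂ (c e) ∘ nested-map mono) , separated-comap mono ∘ s

module StrongFamily (k : ℕ) = PairFamily {k} StrongPair strongPair? strongPair-map strongPair-comap

-- Existence of the extremal number.

numEdges-cong : ∀ {n} {G H : OGraph n} → (∀ i j → G i j ≡ H i j) → numEdges G ≡ numEdges H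
numEdges-cong {n} G≡H = cong sum (map-cong (λ i → cong sum (map-cong
  (λ j → cong (λ b → if (toℕ i <ᵇ toℕ j) ∧ b then 1 else 0) (G≡H i j)) (allFin n))) (allFin n))

free-cong : ∀ {n k} {𝓗 : Family k} {G H : OGraph n} → (∀ i j → G i j ≡ H i j) → Free G 𝓗 → Free H 𝓗
free-cong G≡H free M fam (f , mono , edge) =
  free M fam (f , mono , λ a b e → map₂ (trans (G≡H _ _)) (edge a b e))

-- Either some free graph has exactly as many edges as the current bound allows, or the bound drops
-- by one. At bound 0 the given free graph attains it.
ex-exists : ∀ {n k} (𝓗 : Family k) → (∀ (G : OGraph n) → Dec (Free G 𝓗)) →
  ∃[ G ] Free {n} G 𝓗 → ∀ B → (∀ (G : OGraph n) → Free G 𝓗 → numEdges G ≤ B) → ∃[ m ] IsEx n 𝓗 m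
ex-exists {n} 𝓗 free? (G₀ , f₀) zero bound = 0 , (G₀ , f₀ , n≤0⇒n≡0 (bound G₀ f₀)) , bound
ex-exists {n} 𝓗 free? G₀ (suc B) bound
  with search-Vec (search-Vec search-Bool n) n {λ v → Free (graph v) 𝓗 × numEdges (graph v) ≡ suc B}
    (λ v → free? (graph v) ×-dec (numEdges (graph v) ≟ suc B))
  where
  graph : Vec (Vec Bool n) n → OGraph n
  graph v i j = lookup (lookup v i) j
... | yes (v , f , eq) = suc B , (_ , f , eq) , bound
... | no ¬v = ex-exists 𝓗 free? G₀ B λ G f → ≤-pred (≤∧≢⇒< (bound G f) (λ eq →
  -- The search runs over tables, so `G` is replaced by its own table, with which it agrees
  -- pointwise.
  let tab = tabulate (λ i → tabulate (G i))
      G≡ : ∀ i j → G i j ≡ lookup (lookup tab i) j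
      G≡ i j = sym (trans (cong (λ v → lookup v j) (lookup∘tabulate (λ i → tabulate (G i)) i)) (lookup∘tabulate (G i) j))
  in ¬v (tab , free-cong G≡ f , trans (sym (numEdges-cong G≡)) eq)))

-- Passage to graphs on the natural numbers.

extend : ∀ {n} → OGraph n → Graph
extend {n} G i j with i <? n | j <? n
... | yes i<n | yes j<n = (i <ᵇ j) ∧ G (fromℕ< i<n) (fromℕ< j<n)
... | _       | _       = false

extend-edge : ∀ {n} (G : OGraph n) {i j} → extend G i j ≡ true →
  Σ (i < n) λ i<n → Σ (j < n) λ j<n → i < j × G (fromℕ< i<n) (fromℕ< j<n) ≡ true
extend-edge {n} G {i} {j} e with i <? n | j <? n
... | yes i<n | yes j<n = let i<j , g = ∧-true {i <ᵇ j} e in i<n , j<n , <ᵇ≡⇒< i<j , g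

extend-toℕ : ∀ {n} (G : OGraph n) i j → extend G (toℕ i) (toℕ j) ≡ (toℕ i <ᵇ toℕ j) ∧ G i j
extend-toℕ {n} G i j with toℕ i <? n | toℕ j <? n
... | yes p | yes q = cong₂ (λ a b → (toℕ i <ᵇ toℕ j) ∧ G a b) (Finₚ.fromℕ<-toℕ i p) (Finₚ.fromℕ<-toℕ j q)
... | yes _ | no ¬q = contradiction (Finₚ.toℕ<n j) ¬q
... | no ¬p | _     = contradiction (Finₚ.toℕ<n i) ¬p

sum-allFin : ∀ n (F : Fin n → ℕ) f → (∀ i → F i ≡ f (toℕ i)) → sum (map F (allFin n)) ≡ ∑ n f
sum-allFin n F f F≡f = trans (cong sum (map-tabulate id F)) (go n F f F≡f)
  where
  go : ∀ n (F : Fin n → ℕ) f → (∀ i → F i ≡ f (toℕ i)) → sum (List.tabulate F) ≡ ∑ n f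
  go zero    F f F≡f = refl
  go (suc n) F f F≡f = trans (cong₂ _+_ (F≡f zero) (go n (F ∘ suc) (f ∘ suc) (F≡f ∘ suc))) (sym (∑-split 1 n f))

numEdges≡edges : ∀ {n} (G : OGraph n) → numEdges G ≡ edges n (extend G)
numEdges≡edges {n} G = begin
  numEdges G
    ≡⟨ sum-allFin n _ (λ i → ∑ n (λ j → ⟦ extend G i j ⟧))
         (λ i → sum-allFin n _ _ (λ j → cong ⟦_⟧ (sym (extend-toℕ G i j)))) ⟩
  ∑ n (λ i → ∑ n (λ j → ⟦ extend G i j ⟧))
    ≡⟨ ∑-swap n n _ ⟩
  ∑ n (λ j → ∑ n (λ i → ⟦ extend G i j ⟧))
    ≡⟨ ∑-cong n (λ j j<n → upper j (<⇒≤ j<n)) ⟩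
  edges n (extend G) ∎
  where
  open ≡-Reasoning
  upper : ∀ j → j ≤ n → ∑ n (λ i → ⟦ extend G i j ⟧) ≡ ∑ j (λ i → ⟦ extend G i j ⟧)
  upper j j≤n with o , j+o≡n ← m≤n⇒∃[o]m+o≡n j≤n =
    trans (cong (λ t → ∑ t (λ i → ⟦ extend G i j ⟧)) (sym j+o≡n)) (trans (∑-split j o _)
      (trans (cong (∑ j (λ i → ⟦ extend G i j ⟧) +_) (∑-zero o (λ i _ → ⟦⟧-zero (λ e →
        <⇒≱ (proj₁ (proj₂ (proj₂ (extend-edge G e)))) (m≤m+n j i))))) (+-identityʳ _)))

-- From chains to strongly non-nested matchings.

chain-points : ∀ {P m i j} → Chain P m i j → Σ (Fin m → ℕ) λ x → Σ (Fin m → ℕ) λ y →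
  (∀ t → P (x t) (y t) × x t < i × y t < j) × (∀ s t → s <ᶠ t → x t < x s × y t < y s)
chain-points [] = (λ ()) , (λ ()) , (λ ()) , λ ()
chain-points {P} {suc m} {i} {j} (_▻_ {x = x₀} {y₀} c (p , x<i , y<j)) with x , y , inside , below ← chain-points c =
  x′ , y′ , inside′ , below′
  where
  x′ y′ : Fin (suc m) → ℕ
  x′ zero = x₀
  x′ (suc t) = x t
  y′ zero = y₀
  y′ (suc t) = y t
  inside′ : ∀ t → P (x′ t) (y′ t) × x′ t < i × y′ t < j
  inside′ zero = p , x<i , y<j
  inside′ (suc t) = let q , x< , y< = inside t in q , <-trans x< x<i , <-trans y< y<j
  below′ : ∀ s t → s <ᶠ t → x′ t < x′ s × y′ t < y′ s
  below′ zero (suc t) _ = proj₂ (inside t)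
  below′ (suc s) (suc t) s<t = below s t (≤-pred s<t)

-- Block numbers may exceed `k`, whereas parts are labelled by `Fin k`; the relabelling keeps the
-- pattern of equalities.
kernel : ∀ k (β : Fin k → ℕ) → Σ (Fin k → Fin k) λ part →
  ∀ i j → (part i ≡ part j → β i ≡ β j) × (β i ≡ β j → part i ≡ part j)
kernel zero β = (λ ()) , λ ()
kernel (suc k) β with part , ker ← kernel k (β ∘ suc) = part′ , ker′
  where
  part′ : Fin (suc k) → Fin (suc k)
  part′ zero = zero
  part′ (suc i) with β (suc i) ≟ β zero
  ... | yes _ = zero
  ... | no  _ = suc (part i)
  ker′ : ∀ i j → (part′ i ≡ part′ j → β i ≡ β j) × (β i ≡ β j → part′ i ≡ part′ j)
  ker′ zero zero = (λ _ → refl) , (λ _ → refl)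
  ker′ zero (suc j) with β (suc j) ≟ β zero
  ... | yes eq = (λ _ → sym eq) , (λ _ → refl)
  ... | no ¬eq = (λ ()) , (λ eq → contradiction (sym eq) ¬eq)
  ker′ (suc i) zero with β (suc i) ≟ β zero
  ... | yes eq = (λ _ → eq) , (λ _ → refl)
  ... | no ¬eq = (λ ()) , (λ eq → contradiction eq ¬eq)
  ker′ (suc i) (suc j) with β (suc i) ≟ β zero | β (suc j) ≟ β zero
  ... | yes p | yes q = (λ _ → trans p (sym q)) , (λ _ → refl)
  ... | yes p | no ¬q = (λ ()) , (λ eq → contradiction (trans (sym eq) p) ¬q)
  ... | no ¬p | yes q = (λ ()) , (λ eq → contradiction (trans eq q) ¬p)
  ... | no ¬p | no ¬q = (λ eq → proj₁ (ker i j) (Finₚ.suc-injective eq)) , (λ eq → cong suc (proj₂ (ker i j) eq))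

disjoint-sym : ∀ {n} {x y u v : Fin n} → Disjoint x y u v → Disjoint u v x y
disjoint-sym (p , q , r , s) = p ∘ sym , r ∘ sym , q ∘ sym , s ∘ sym

crossing-sym : ∀ {n} {x y u v : Fin n} → Crossing x y u v → Crossing u v x y
crossing-sym (¬s , ¬n) = ¬s ∘ swap , ¬n ∘ swap

strong-sym : ∀ {n k} {x y u v : Fin n} {p q : Fin k} → StrongPair x y u v p q → StrongPair u v x y q p
strong-sym (c , s) = crossing-sym ∘ c ∘ sym , λ q≢p → swap (s (q≢p ∘ sym))

ascending-pair : ∀ {n k} {x y u v : Fin n} {p q : Fin k} → x <ᶠ y → u <ᶠ v → x <ᶠ u → y <ᶠ v →
  (p ≡ q × u <ᶠ y) ⊎ (p ≢ q × y <ᶠ u) → Disjoint x y u v × StrongPair x y u v p q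
ascending-pair {x = x} {y} {u} {v} {p} {q} x<y u<v x<u y<v rel =
  ((λ e → Finₚ.<-irrefl e x<u) , (λ e → Finₚ.<-irrefl e (Finₚ.<-trans x<u u<v)) , y≢u rel , (λ e → Finₚ.<-irrefl e y<v)) , pair rel
  where
  y≢u : (p ≡ q × u <ᶠ y) ⊎ (p ≢ q × y <ᶠ u) → y ≢ u
  y≢u (inj₁ (_ , u<y)) e = Finₚ.<-irrefl (sym e) u<y
  y≢u (inj₂ (_ , y<u)) e = Finₚ.<-irrefl e y<u
  pair : (p ≡ q × u <ᶠ y) ⊎ (p ≢ q × y <ᶠ u) → StrongPair x y u v p q
  pair (inj₁ (p≡q , u<y)) =
    (λ _ → [ Finₚ.<-asym u<y , (λ v<x → Finₚ.<-asym v<x (Finₚ.<-trans x<u u<v)) ]′ ,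
           [ (λ (_ , v<y) → Finₚ.<-asym y<v v<y) , (λ (u<x , _) → Finₚ.<-asym x<u u<x) ]′) ,
    λ p≢q → contradiction p≡q p≢q
  pair (inj₂ (p≢q , y<u)) = (λ p≡q → contradiction p≡q p≢q) , λ _ → inj₁ y<u

-- The values of `β` at the right ends determine the parts. Any two edges of a chain are ordered at
-- both ends, so they are never nested, and `rel` only has to tell crossing from separated.
chain⇒placement : ∀ {n k i j P} (G : OGraph n) (β : ℕ → ℕ) → (∀ {x y} → P x y → extend G x y ≡ true) →
  (∀ {x y u v} → P x y → P u v → u < i → x < u → y < v → (β y ≡ β v × u < y) ⊎ (β y ≢ β v × y < u)) →
  Chain P k i j → ∃[ e ] StrongFamily.Placement k G e
chain⇒placement {n} {k} {i} {P = P} G β P⇒G rel c with x , y , inside , below ← chain-points c =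
  (λ t → X t , Y t , part t) , λ s t → (x<y s , proj₂ (proj₂ (proj₂ (edge s)))) , pair s t
  where
  edge : ∀ t → _
  edge t = extend-edge G (P⇒G (proj₁ (inside t)))
  X Y : Fin k → Fin n
  X t = fromℕ< (proj₁ (edge t))
  Y t = fromℕ< (proj₁ (proj₂ (edge t)))
  X≡ : ∀ t → toℕ (X t) ≡ x t
  X≡ t = Finₚ.toℕ-fromℕ< (proj₁ (edge t))
  Y≡ : ∀ t → toℕ (Y t) ≡ y t
  Y≡ t = Finₚ.toℕ-fromℕ< (proj₁ (proj₂ (edge t)))
  infix 4 _≺_
  _≺_ : ∀ {a b} {u v : Fin n} → toℕ u ≡ a → toℕ v ≡ b → a < b → u <ᶠ v
  (p ≺ q) a<b = subst₂ _<_ (sym p) (sym q) a<b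
  x<y : ∀ t → X t <ᶠ Y t
  x<y t = (X≡ t ≺ Y≡ t) (proj₁ (proj₂ (proj₂ (edge t))))
  part = proj₁ (kernel k (β ∘ y))
  ker = proj₂ (kernel k (β ∘ y))
  ordered : ∀ s t → s <ᶠ t → Disjoint (X t) (Y t) (X s) (Y s) × StrongPair (X t) (Y t) (X s) (Y s) (part t) (part s)
  ordered s t s<t with xt<xs , yt<ys ← below s t s<t =
    ascending-pair (x<y t) (x<y s) ((X≡ t ≺ X≡ s) xt<xs) ((Y≡ t ≺ Y≡ s) yt<ys)
      (case rel (proj₁ (inside t)) (proj₁ (inside s)) (proj₁ (proj₂ (inside s))) xt<xs yt<ys of λ
        { (inj₁ (eq , xs<yt)) → inj₁ (proj₂ (ker t s) eq , (X≡ s ≺ Y≡ t) xs<yt)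
        ; (inj₂ (ne , yt<xs)) → inj₂ (ne ∘ proj₁ (ker t s) , (Y≡ t ≺ X≡ s) yt<xs) })
  pair : ∀ s t → s ≢ t → Disjoint (X s) (Y s) (X t) (Y t) × StrongPair (X s) (Y s) (X t) (Y t) (part s) (part t)
  pair s t s≢t with Finₚ.<-cmp s t
  ... | tri< s<t _ _ = let d , r = ordered s t s<t in disjoint-sym d , strong-sym r
  ... | tri≈ _ s≡t _ = contradiction s≡t s≢t
  ... | tri> _ _ t<s = ordered t s t<s

-- Right ends in one block differ by less than the common length, so the edges cross. If the blocks
-- differ, they are not consecutive, a whole block lies between the right ends, and the edges are
-- separated.
block-relation : ∀ d c → Alternating c → ∀ {x y u v} → c (y / suc d) ≡ true → c (v / suc d) ≡ true →
  x + suc d ≡ y → u + suc d ≡ v → y < v →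
  (y / suc d ≡ v / suc d × u < y) ⊎ (y / suc d ≢ v / suc d × y < u)
block-relation d c alt {x} {y} {u} {v} cy cv x+δ≡y u+δ≡v y<v with y / suc d ≟ v / suc d
... | yes eq = inj₁ (eq , +-cancelʳ-< δ u y (begin-strict
    u + δ                   ≡⟨ u+δ≡v ⟩
    v                       ≡⟨ m≡m%n+[m/n]*n v δ ⟩
    v % δ + v / δ * δ       <⟨ +-monoˡ-< _ (m%n<n v δ) ⟩
    δ + v / δ * δ           ≡⟨ cong (λ b → δ + b * δ) eq ⟨
    δ + y / δ * δ           ≤⟨ +-monoʳ-≤ δ (block≤ y) ⟩
    δ + y                   ≡⟨ +-comm δ y ⟩
    y + δ                   ∎))
  where
  open ≤-Reasoning
  δ = suc d
  block≤ : ∀ y → y / suc d * suc d ≤ y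
  block≤ y = subst (y / δ * δ ≤_) (sym (m≡m%n+[m/n]*n y δ)) (m≤n+m _ (y % δ))
... | no ne = inj₂ (ne , +-cancelʳ-< δ y u (begin-strict
    y + δ                       ≡⟨ cong (_+ δ) (m≡m%n+[m/n]*n y δ) ⟩
    y % δ + y / δ * δ + δ       <⟨ +-monoˡ-< δ (+-monoˡ-< _ (m%n<n y δ)) ⟩
    δ + y / δ * δ + δ           ≡⟨ +-comm _ δ ⟩
    (2 + y / δ) * δ             ≤⟨ *-monoˡ-≤ δ two ⟩
    v / δ * δ                   ≤⟨ m≤n+m _ (v % δ) ⟩
    v % δ + v / δ * δ           ≡⟨ m≡m%n+[m/n]*n v δ ⟨
    v                           ≡⟨ u+δ≡v ⟨
    u + δ                       ∎))
  where
  open ≤-Reasoning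
  δ = suc d
  two : 2 + y / suc d ≤ v / suc d
  two = ≤∧≢⇒< (≤∧≢⇒< (/-monoˡ-≤ δ (<⇒≤ y<v)) ne)
    (λ eq → alt (y / δ) cy (trans (cong c eq) cv))

-- The upper bound.

2*nC2 : ∀ n → 2 * (n C 2) + n ≡ n * n
2*nC2 zero = refl
2*nC2 (suc n) = begin
  2 * (suc n C 2) + suc n             ≡⟨ cong (λ t → 2 * t + suc n) (nCk+nC[k+1]≡[n+1]C[k+1] n 1) ⟨
  2 * (n C 1 + n C 2) + suc n         ≡⟨ cong (λ t → 2 * (t + n C 2) + suc n) (nC1≡n n) ⟩
  2 * (n + n C 2) + suc n             ≡⟨ eq₁ n (n C 2) ⟩
  (2 * (n C 2) + n) + (2 * n + 1)     ≡⟨ cong (_+ (2 * n + 1)) (2*nC2 n) ⟩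
  n * n + (2 * n + 1)                 ≡⟨ eq₂ n ⟩
  suc n * suc n                       ∎
  where
  open ≡-Reasoning
  eq₁ : ∀ n c → 2 * (n + c) + (1 + n) ≡ (2 * c + n) + (2 * n + 1)
  eq₁ = solve-∀
  eq₂ : ∀ n → n * n + (2 * n + 1) ≡ (1 + n) * (1 + n)
  eq₂ = solve-∀

upper-bound : ∀ κ n (G : OGraph n) → 1 + 2 * κ ≤ n → Free G (StrongNonNestFam (suc κ)) →
  numEdges G ≤ κ * n + κ C 2
upper-bound κ n G n≥ free = *-cancelˡ-≤ 2 (+-cancelʳ-≤ κ _ _ (begin
    2 * numEdges G + κ            ≡⟨ cong (λ t → 2 * t + κ) (numEdges≡edges G) ⟩
    2 * edges n (extend G) + κ    ≤⟨ edges-bound κ n (extend G) n≥ crossing diagonals ⟩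
    2 * (κ * n) + κ * κ           ≡⟨ cong (2 * (κ * n) +_) (2*nC2 κ) ⟨
    2 * (κ * n) + (2 * (κ C 2) + κ) ≡⟨ eq (κ * n) (κ C 2) κ ⟩
    2 * (κ * n + κ C 2) + κ       ∎))
  where
  open ≤-Reasoning
  eq : ∀ a c k → 2 * a + (2 * c + k) ≡ 2 * (a + c) + k
  eq = solve-∀
  no-placement : ¬ (∃[ e ] StrongFamily.Placement (suc κ) G e)
  no-placement (e , p) = let M , fam , copy = StrongFamily.placement⇒copy (suc κ) {G = G} e p in free M fam copy
  crossing : ¬ Crossings (extend G) (suc κ) n
  -- All edges form a single part: every left end is below `q` and every right end is at least `q`.
  crossing (q , c) = no-placement (chain⇒placement G (λ _ → 0) proj₁
    (λ (_ , q≤y) _ u<q _ _ → inj₁ (refl , <-≤-trans u<q q≤y)) c)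
  diagonals : ∀ d c → Alternating c → ¬ Chain (DiagonalEdge (extend G) d c) (suc κ) n n
  diagonals d c alt ch = no-placement (chain⇒placement G (_/ suc d) proj₁
    (λ (_ , x≡ , cy) (_ , u≡ , cv) _ _ y<v → block-relation d c alt cy cv x≡ u≡ y<v) ch)

-- The lower bound.

hub : ∀ κ n → OGraph n
hub κ n i j = (toℕ i <ᵇ κ) ∨ (toℕ j <ᵇ (1 + 2 * κ))

-- The first `1 + 2 * κ` vertices span all pairs, which average κ per vertex; each later vertex is
-- joined to the first κ vertices.
hub-edges : ∀ κ n → 1 + 2 * κ ≤ n → κ * n ≤ numEdges (hub κ n)
hub-edges κ n n≥ with t , refl ← m≤n⇒∃[o]m+o≡n n≥ = begin
    κ * (N + t)                               ≡⟨ *-distribˡ-+ κ N t ⟩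
    κ * N + κ * t                             ≡⟨ cong₂ _+_ (sym (∑-id-odd κ)) (trans (*-comm κ t) (sym (∑-const t κ))) ⟩
    ∑ N (λ j → j) + ∑ t (λ _ → κ)             ≤⟨ +-mono-≤
      (∑-mono N (λ j j<N → full j j (<-≤-trans j<N (m≤m+n N t)) ≤-refl (λ i i<j → ∨-introʳ {i <ᵇ κ} (<⇒<ᵇ≡ j<N))))
      (∑-mono t (λ j j<t → full (N + j) κ (+-monoʳ-< N j<t) (κ≤ j) (λ i i<κ → ∨-introˡ (<⇒<ᵇ≡ i<κ)))) ⟩
    ∑ N column + ∑ t (λ j → column (N + j))   ≡⟨ ∑-split N t column ⟨
    edges (N + t) (extend (hub κ (N + t)))    ≡⟨ numEdges≡edges (hub κ (N + t)) ⟨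
    numEdges (hub κ (N + t))                  ∎
  where
  open ≤-Reasoning
  N = 1 + 2 * κ
  column : ℕ → ℕ
  column j = ∑ j (λ i → ⟦ extend (hub κ (N + t)) i j ⟧)
  κ≤ : ∀ j → κ ≤ N + j
  κ≤ j = ≤-trans (m≤m+n κ (κ + 0)) (≤-trans (n≤1+n (2 * κ)) (m≤m+n N j))
  value : ∀ {i j} → i < j → j < N + t → (i <ᵇ κ) ∨ (j <ᵇ N) ≡ true → extend (hub κ (N + t)) i j ≡ true
  value {i} {j} i<j j<n h = subst₂ (λ a b → extend (hub κ (N + t)) a b ≡ true) (Finₚ.toℕ-fromℕ< i<n) (Finₚ.toℕ-fromℕ< j<n)
    (trans (extend-toℕ (hub κ (N + t)) (fromℕ< i<n) (fromℕ< j<n)) both)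
    where
    i<n = <-trans i<j j<n
    both : (toℕ (fromℕ< i<n) <ᵇ toℕ (fromℕ< j<n)) ∧ hub κ (N + t) (fromℕ< i<n) (fromℕ< j<n) ≡ true
    both rewrite Finₚ.toℕ-fromℕ< i<n | Finₚ.toℕ-fromℕ< j<n = ∧-intro (<⇒<ᵇ≡ i<j) h
  full : ∀ j m → j < N + t → m ≤ j → (∀ i → i < m → (i <ᵇ κ) ∨ (j <ᵇ N) ≡ true) → m ≤ column j
  full j m j<n m≤j h with o , refl ← m≤n⇒∃[o]m+o≡n m≤j = begin
    m                                                    ≡⟨ trans (∑-const m 1) (*-identityʳ m) ⟨
    ∑ m (λ _ → 1)                                        ≡⟨ ∑-cong m (λ i i<m → cong ⟦_⟧ (sym (value (<-≤-trans i<m m≤j) j<n (h i i<m)))) ⟩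
    ∑ m (λ i → ⟦ extend (hub κ (N + t)) i (m + o) ⟧)     ≤⟨ m≤m+n _ _ ⟩
    _                                                    ≡⟨ ∑-split m o _ ⟨
    column (m + o)                                       ∎

argmax : ∀ κ (g : Fin (suc κ) → ℕ) → ∃[ i ] ∀ j → g j ≤ g i
argmax zero g = zero , λ { zero → ≤-refl }
argmax (suc κ) g with i , max ← argmax κ (g ∘ suc) with ≤-total (g zero) (g (suc i))
... | inj₁ p = suc i , λ { zero → p ; (suc j) → max j }
... | inj₂ p = zero , λ { zero → ≤-refl ; (suc j) → ≤-trans (max j) p }

injective-bounded : ∀ {m n B} (h : Fin m → Fin n) → Injective _≡_ _≡_ h → (∀ i → toℕ (h i) < B) → m ≤ B
injective-bounded h inj h<B = Finₚ.injective⇒≤ {f = λ i → fromℕ< (h<B i)}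
  (λ {i} {j} eq → inj (Finₚ.toℕ-injective (Finₚ.fromℕ<-injective _ _ (h<B i) (h<B j) eq)))

mono-increasing : ∀ {m n} {f : Fin m → Fin n} → StrictlyMonotone f → ∀ a → toℕ a ≤ toℕ (f a)
mono-increasing mono zero = z≤n
mono-increasing mono (suc a) = ≤-<-trans
  (mono-increasing (λ b c b<c → mono (inject₁ b) (inject₁ c) (subst₂ _<_ (sym (Finₚ.toℕ-inject₁ b)) (sym (Finₚ.toℕ-inject₁ c)) b<c)) a)
  (mono (inject₁ a) (suc a) (s≤s (≤-reflexive (Finₚ.toℕ-inject₁ a))))

-- All left ends lie at or before the largest one. By non-nestedness the edge with that left end
-- also has the largest right end, so all `2 * κ + 2` endpoints lie at or before the latter.
last-edge : ∀ κ (M : Matching (suc κ)) → NonNested M →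
  ∃[ i ] (κ ≤ toℕ (lo M i) × 1 + 2 * κ ≤ toℕ (hi M i))
last-edge κ M nn with i , max ← argmax κ (λ i → toℕ (lo M i)) = i , lo≥ , hi≥
  where
  lo≥ : κ ≤ toℕ (lo M i)
  lo≥ = ≤-pred (injective-bounded (lo M)
    (λ {a} {b} eq → case a ≟ᶠ b of λ { (yes a≡b) → a≡b ; (no a≢b) → contradiction eq (proj₁ (disjoint M a b a≢b)) })
    (λ j → s≤s (max j)))
  hi≤ : ∀ j → toℕ (hi M j) ≤ toℕ (hi M i)
  hi≤ j with i ≟ᶠ j
  ... | yes refl = ≤-refl
  ... | no i≢j = ≮⇒≥ λ i<j → nn i j i≢j
    (inj₂ (≤∧≢⇒< (max j) (λ eq → proj₁ (disjoint M i j i≢j) (sym (Finₚ.toℕ-injective eq))) , i<j))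
  below : ∀ s → toℕ ([ lo M , hi M ]′ s) < suc (toℕ (hi M i))
  below (inj₁ j) = s≤s (≤-trans (max j) (<⇒≤ (lo<hi M i)))
  below (inj₂ j) = s≤s (hi≤ j)
  hi≥ : 1 + 2 * κ ≤ toℕ (hi M i)
  hi≥ = ≤-pred (subst (_≤ suc (toℕ (hi M i))) (eq κ)
    (injective-bounded (endpoints (lo M) (hi M)) (endpoints-injective (lo<hi M) (disjoint M))
      (λ a → below (splitAt (suc κ) a))))
    where
    eq : ∀ κ → (1 + κ) + (1 + κ) ≡ 1 + (1 + 2 * κ)
    eq = solve-∀

hub-free : ∀ κ n → Free (hub κ n) (NonNestFam (suc κ))
hub-free κ n M nn (f , mono , edge) with i , lo≥ , hi≥ ← last-edge κ M nn
  with ∨-true (proj₂ (edge _ _ (i , refl , refl)))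
... | inj₁ p = <⇒≱ (<ᵇ≡⇒< p) (≤-trans lo≥ (mono-increasing mono _))
... | inj₂ p = <⇒≱ (<ᵇ≡⇒< {n = 1 + 2 * κ} p) (≤-trans hi≥ (mono-increasing mono _))

-- Comparison of the two families, and the conclusion.

strong⇒nonNested : ∀ {k} (M : Matching k) → StronglyNonNested M → NonNested M
strong⇒nonNested M (part , strong) i j i≢j nested with part i ≟ᶠ part j
... | yes eq = proj₂ (proj₁ (strong i j i≢j) eq) nested
... | no ne = absurd (proj₂ (strong i j i≢j) ne) nested
  where
  absurd : Separated (lo M i) (hi M i) (lo M j) (hi M j) → ¬ Nested (lo M i) (hi M i) (lo M j) (hi M j)
  absurd (inj₁ y<u) (inj₁ (_ , v<y)) = Finₚ.<-asym y<u (Finₚ.<-trans (lo<hi M j) v<y)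
  absurd (inj₁ y<u) (inj₂ (u<x , _)) = Finₚ.<-asym y<u (Finₚ.<-trans u<x (lo<hi M i))
  absurd (inj₂ v<x) (inj₁ (x<u , _)) = Finₚ.<-asym v<x (Finₚ.<-trans x<u (lo<hi M j))
  absurd (inj₂ v<x) (inj₂ (_ , y<v)) = Finₚ.<-asym v<x (Finₚ.<-trans (lo<hi M i) y<v)

-- The strong family is the smaller one and is avoided by more graphs, whence `m₁ ≤ m₂`.
weaken-free : ∀ {k n} (G : OGraph n) → Free G (NonNestFam k) → Free G (StrongNonNestFam k)
weaken-free G free M strong = free M (strong⇒nonNested M strong)

nonNest-free? : ∀ k {n} (G : OGraph n) → Dec (Free G (NonNestFam k))
-- `PairFamily` asks for a labelling of the edges; `id` supplies one.
nonNest-free? k G = map′ (λ free M nn → free M (id , nn)) (λ free M (_ , nn) → free M nn)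
  (NonNestedFamily.free? k G)

theorem2p2 : ∀ (n k : ℕ) → 1 ≤ k → 2 * k ≤ n →
    ∃[ m₁ ] ∃[ m₂ ] (IsEx n (NonNestFam k) m₁ × IsEx n (StrongNonNestFam k) m₂ ×
    ((k ∸ 1) * n ≤ m₁) × (m₁ ≤ m₂) × (m₂ ≤ (k ∸ 1) * n + ((k ∸ 1) C 2)))
theorem2p2 n (suc κ) _ 2k≤n =
  let ex₁@(m₁ , (G₁ , free₁ , eq₁) , max₁) =
        ex-exists (NonNestFam (suc κ)) (nonNest-free? (suc κ)) (hub κ n , hub-free κ n) B
          (λ G free → upper G (weaken-free G free))
      ex₂@(m₂ , (G₂ , free₂ , eq₂) , max₂) =
        ex-exists (StrongNonNestFam (suc κ)) (StrongFamily.free? (suc κ)) (hub κ n , weaken-free (hub κ n) (hub-free κ n)) B upper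
  in m₁ , m₂ , proj₂ ex₁ , proj₂ ex₂ ,
     ≤-trans (hub-edges κ n n≥) (max₁ (hub κ n) (hub-free κ n)) ,
     subst (_≤ m₂) eq₁ (max₂ G₁ (weaken-free G₁ free₁)) ,
     subst (_≤ B) eq₂ (upper G₂ free₂)
  where
  B = κ * n + κ C 2
  n≥ : 1 + 2 * κ ≤ n
  n≥ = ≤-trans (≤-trans (n≤1+n _) (≤-reflexive (eq κ))) 2k≤n
    where
    eq : ∀ κ → 2 + 2 * κ ≡ 2 * (1 + κ)
    eq = solve-∀
  upper : ∀ G → Free G (StrongNonNestFam (suc κ)) → numEdges G ≤ B
  upper G = upper-bound κ n G n≥
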